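{- Let $\alpha$ be a real number not in $\mathbb{Q}(\mathbf{H}_4)$ and let $\{p_i/q_i\}_{i\ge1}$ be the sequence of all $\mathbf{H}_4$-best approximations of $\alpha$, ordered so that $q_i<q_{i+1}$. Then $$K(\alpha)=\limsup_{i\to\infty}q_i\,|q_{i-1}\alpha-p_{i-1}|.$$
   Context: The Hecke group $\mathbf{H}_4$ is the subgroup of $\mathrm{PSL}_2(\mathbb{R})$ generated by $\begin{pmatrix}1&\sqrt2\\0&1\end{pmatrix}$ and $\begin{pmatrix}0&-1\\1&0\end{pmatrix}$. The set $\mathbb{Q}(\mathbf{H}_4)\subset \mathbb{R}\cup\{\infty\}$ is the set of all $p/q$ such that $\begin{pmatrix} p & r \\ q & s \end{pmatrix}\in\mathbf{H}_4$ for some $r,s$; its finite elements form the set $\sqrt2\,\mathbb{Q}$. Writing $p/q\in\mathbb{Q}(\mathbf{H}_4)$ always means the normalized form: $(p,q)$ is the first column of a matrix in $\mathbf{H}_4$ with $q>0$. Explicitly, either $p=a$, $q=\sqrt2\,c$ with $a,c\in\mathbb{Z}$, $c>0$, $\gcd(a,2c)=1$, or $p=\sqrt2\,a$, $q=c$ with $a,c\in\mathbb{Z}$, $c>0$, $\gcd(2a,c)=1$. $p/q\in\mathbb{Q}(\mathbf{H}_4)$ is an $\mathbf{H}_4$-best approximation of a real number $\alpha$ if for any $r/s\in\mathbb{Q}(\mathbf{H}_4)$ with $r/s\ne p/q$ and $0<s\le q$ one has $|s\alpha-r|>|q\alpha-p|$. Distinct best approximations have distinct denominators. For a real number $\alpha$,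 $K(\alpha)$ is the infimum of those $K>0$ such that for all sufficiently large real $N$ there is $p/q\in\mathbb{Q}(\mathbf{H}_4)$ with $|q\alpha-p|<\frac{K}{N}$ and $1\le q\le N$. -}

module Defs where

open import Level using (0ℓ)
open import Algebra.Bundles using (CommutativeRing; Group)
open import Axiom.ExcludedMiddle using (ExcludedMiddle)
open import Data.Nat.Base as ℕ using (ℕ)
open import Data.Product.Base using (∃; ∃-syntax; _×_; _,_; proj₁; proj₂)
open import Data.Sum.Base using (_⊎_; inj₁; inj₂)
open import Relation.Binary.Core using (Rel)
open import Relation.Binary.Definitions using (tri<; tri≈; tri>)
open import Relation.Binary.Structures using (IsStrictTotalOrder)
open import Relation.Nullary using (¬_; yes; no; contradiction)
open import Relation.Nullary.Construct.Add.Extrema using (_±; ⊥±; ⊤±; [_])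
open import Relation.Unary using (Pred; _∈_)
import Algebra.Properties.CommutativeSemigroup as CommutativeSemigroupProperties
import Algebra.Properties.Ring as RingProperties
import Algebra.Solver.Ring.NaturalCoefficients.Default as NatSolver
import Relation.Binary.Construct.Add.Extrema.Equality as ExtremaEquality
import Relation.Binary.Construct.StrictToNonStrict as StrictToNonStrict
import Relation.Binary.Reasoning.Setoid as SetoidReasoning

module Bounds {A : Set} (_≤_ : Rel A 0ℓ) where
  IsUpperBound IsLowerBound IsSupremum IsInfimum : Pred A 0ℓ → Pred A 0ℓ
  IsUpperBound S u = ∀ {x} → x ∈ S → x ≤ u
  IsLowerBound S l = ∀ {x} → x ∈ S → l ≤ x
  IsSupremum   S s = IsUpperBound S s × (∀ {u} → IsUpperBound S u → s ≤ u)
  IsInfimum    S i = IsLowerBound S i × (∀ {l} → IsLowerBound S l → l ≤ i)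

-- The real numbers enter axiomatically, as a Dedekind complete ordered field;
-- any two of these are isomorphic.  The order is decided by `compare`, so the
-- axioms are the classical ones.  The value of 0# ⁻¹ is unconstrained.
record CompleteOrderedField : Set₁ where
  field
    commutativeRing : CommutativeRing 0ℓ 0ℓ

  open CommutativeRing commutativeRing public
    renaming (Carrier to ℝ; _≉_ to infix 4 _≉_)

  infix 4 _<_
  infix 8 _⁻¹

  field
    _<_                : Rel ℝ 0ℓ
    isStrictTotalOrder : IsStrictTotalOrder _≈_ _<_
    0<1                : 0# < 1#
    +-monoˡ-<          : ∀ {x y} z → x < y → x + z < y + z
    *-pos              : ∀ {x y} → 0# < x → 0# < y → 0# < x * y
    _⁻¹                : ℝ → ℝ
    *-inverseʳ         : ∀ {x} → x ≉ 0# → x * x ⁻¹ ≈ 1#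

  open StrictToNonStrict _≈_ _<_ public using (_≤_)

  open Bounds _≤_ public

  field
    complete : (S : Pred ℝ 0ℓ) → ∃ S → ∃ (IsUpperBound S) → ∃ (IsSupremum S)

  module Order = IsStrictTotalOrder isStrictTotalOrder

  infixl 7 _/_
  _/_ : ℝ → ℝ → ℝ
  x / y = x * y ⁻¹

  ∣_∣ : ℝ → ℝ
  ∣ x ∣ with Order.compare x 0#
  ... | tri< _ _ _ = - x
  ... | tri≈ _ _ _ = x
  ... | tri> _ _ _ = x

  2# : ℝ
  2# = 1# + 1#

  infimum : (S : Pred ℝ 0ℓ) → ∃ S → ∃ (IsLowerBound S) → ∃ (IsInfimum S)
  infimum S (y , y∈S) bounded with complete (IsLowerBound S) bounded (y , λ l → l y∈S)
  ... | i , upper , least = i , (λ x∈S → least (λ l → l x∈S)) , upper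

module SquareRoot (R : CompleteOrderedField) where
  open CompleteOrderedField R
  private
    module S = NatSolver commutativeSemiring
  open S using (solve; _:=_; _:+_; _:*_; con)

  private
    <-trans : ∀ {x y z} → x < y → y < z → x < z
    <-trans = Order.trans

    respˡ : ∀ {x y z} → x ≈ y → x < z → y < z
    respˡ = Order.<-respˡ-≈

    respʳ : ∀ {x y z} → x ≈ y → z < x → z < y
    respʳ = Order.<-respʳ-≈

    +-monoʳ-< : ∀ {x y} z → x < y → z + x < z + y
    +-monoʳ-< z x<y = respˡ (+-comm _ z) (respʳ (+-comm _ z) (+-monoˡ-< z x<y))

    +-pos : ∀ {x y} → 0# < x → 0# < y → 0# < x + y
    +-pos {x} {y} 0<x 0<y = <-trans 0<y (respˡ (+-identityˡ y) (+-monoˡ-< y 0<x))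

    0<2 : 0# < 2#
    0<2 = +-pos 0<1 0<1

    <⇒0<- : ∀ {x y} → x < y → 0# < y - x
    <⇒0<- {x} x<y = respˡ (-‿inverseʳ x) (+-monoˡ-< (- x) x<y)

    gap : ∀ {x y} → x < y → ∃ λ d → 0# < d × y ≈ x + d
    gap {x} {y} x<y = y - x , <⇒0<- x<y ,
      (begin
         y              ≈⟨ +-identityˡ y ⟨
         0# + y         ≈⟨ +-congʳ (-‿inverseʳ x) ⟨
         x - x + y      ≈⟨ +-assoc _ _ _ ⟩
         x + (- x + y)  ≈⟨ +-congˡ (+-comm _ _) ⟩
         x + (y - x)    ∎)
      where open SetoidReasoning setoid

    ungap : ∀ {x y d} → 0# < d → y ≈ x + d → x < y
    ungap {x} 0<d y≈ = respʳ (sym y≈) (respˡ (+-identityʳ x) (+-monoʳ-< x 0<d))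

    asym : ∀ {x y} → x < y → ¬ (y < x)
    asym = Order.asym

    sq-mono-< : ∀ {x y} → 0# < x → x < y → x * x < y * y
    sq-mono-< {x} {y} 0<x x<y with gap x<y
    ... | d , 0<d , y≈x+d =
      ungap (+-pos (*-pos 0<d 0<x) (*-pos 0<d (+-pos 0<x 0<d)))
            (trans (*-cong y≈x+d y≈x+d)
                   (solve 2 (λ x d → (x :+ d) :* (x :+ d) :=
                                     x :* x :+ (d :* x :+ d :* (x :+ d))) refl x d))

    ≤⇒≯ : ∀ {x y} → x ≤ y → ¬ (y < x)
    ≤⇒≯ (inj₁ x<y) y<x = asym x<y y<x
    ≤⇒≯ (inj₂ x≈y) y<x = Order.irrefl (sym x≈y) y<x

    0<⇒≉0 : ∀ {x} → 0# < x → x ≉ 0#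
    0<⇒≉0 0<x x≈0 = Order.irrefl (sym x≈0) 0<x

    pos*neg : ∀ {x y} → 0# < x → y < 0# → x * y < 0#
    pos*neg {x} {y} 0<x y<0 with gap y<0
    ... | d , 0<d , 0≈y+d =
      ungap (*-pos 0<x 0<d) (trans (sym (zeroʳ x)) (trans (*-congˡ 0≈y+d) (distribˡ x y d)))

    ⁻¹-pos : ∀ {x} → 0# < x → 0# < x ⁻¹
    ⁻¹-pos {x} 0<x with Order.compare (x ⁻¹) 0#
    ... | tri> _ _ 0<x⁻¹ = 0<x⁻¹
    ... | tri≈ _ x⁻¹≈0 _ = contradiction 0<1
      (Order.irrefl (trans (sym (zeroʳ x)) (trans (*-congˡ (sym x⁻¹≈0)) (*-inverseʳ (0<⇒≉0 0<x)))))
    ... | tri< x⁻¹<0 _ _ = contradiction 0<1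
      (asym (respˡ (*-inverseʳ (0<⇒≉0 0<x)) (pos*neg 0<x x⁻¹<0)))

    below : Pred ℝ 0ℓ
    below x = 0# < x × x * x < 2#

    1∈below : below 1#
    1∈below = 0<1 , respˡ (sym (*-identityʳ 1#)) (ungap 0<1 refl)

    2-bound : IsUpperBound below 2#
    2-bound {x} (0<x , x²<2) with Order.compare x 2#
    ... | tri< x<2 _ _ = inj₁ x<2
    ... | tri≈ _ x≈2 _ = inj₂ x≈2
    ... | tri> _ _ 2<x = contradiction x²<2
      (asym (<-trans (ungap 0<2 (solve 0 ((con 2 :* con 2) := (con 2 :+ con 2)) refl))
                     (sq-mono-< 0<2 2<x)))

    -- The step s ↦ t = (2s + 2)/(s + 2) satisfies t - s = (2 - s²)/(s + 2) and
    -- t² - 2 = 2(s² - 2)/(s + 2)², so it moves s towards √2 without passing it.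
    module Step (s : ℝ) (0<s : 0# < s) where
      w : ℝ
      w = (s + 2#) ⁻¹

      0<s+2 : 0# < s + 2#
      0<s+2 = +-pos 0<s 0<2

      0<w : 0# < w
      0<w = ⁻¹-pos 0<s+2

      w-inv : (s + 2#) * w ≈ 1#
      w-inv = *-inverseʳ (0<⇒≉0 0<s+2)

      t : ℝ
      t = (2# * s + 2#) * w

      0<t : 0# < t
      0<t = *-pos (+-pos (*-pos 0<2 0<s) 0<2) 0<w

      s≈ : s ≈ s * ((s + 2#) * w)
      s≈ = sym (trans (*-congˡ w-inv) (*-identityʳ s))

      2≈ : 2# ≈ 2# * (((s + 2#) * w) * ((s + 2#) * w))
      2≈ = sym (trans (*-congˡ (trans (*-cong w-inv w-inv) (*-identityʳ 1#))) (*-identityʳ 2#))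

      module Up (s²<2 : s * s < 2#) where
        d = proj₁ (gap s²<2)
        0<d = proj₁ (proj₂ (gap s²<2))
        2≈s²+d = proj₂ (proj₂ (gap s²<2))

        s<t : s < t
        s<t = ungap (*-pos 0<d 0<w)
          (trans (*-congʳ (+-congˡ 2≈s²+d))
            (trans (solve 3 (λ s d w → (con 2 :* s :+ (s :* s :+ d)) :* w :=
                                       s :* ((s :+ con 2) :* w) :+ d :* w) refl s d w)
                   (+-congʳ (sym s≈))))

        t²<2 : t * t < 2#
        t²<2 = ungap (*-pos 0<2 (*-pos 0<d (*-pos 0<w 0<w)))
          (trans 2≈
            (trans (solve 2 (λ s w → con 2 :* (((s :+ con 2) :* w) :* ((s :+ con 2) :* w)) :=
                                     (con 2 :* (s :* s) :+ con 4 :* con 2 :* s :+ con 4 :* con 2) :* (w :* w))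
                            refl s w)
            (trans (*-congʳ expand)
                   (solve 3 (λ s d w → (con 4 :* (s :* s) :+ con 4 :* con 2 :* s :+ con 4 :+ con 2 :* d) :* (w :* w) :=
                                       ((con 2 :* s :+ con 2) :* w) :* ((con 2 :* s :+ con 2) :* w)
                                       :+ con 2 :* (d :* (w :* w))) refl s d w))))
          where
          -- 2s² + 8s + 8 = 4s² + 8s + 4 + 2d, using 2 = s² + d twice
          expand : _ ≈ _
          expand =
            trans (solve 1 (λ s → con 2 :* (s :* s) :+ con 4 :* con 2 :* s :+ con 4 :* con 2 :=
                                  con 2 :* (s :* s) :+ con 4 :* con 2 :* s :+ con 4 :+ con 2 :* con 2) refl s)
            (trans (+-congˡ (*-congˡ 2≈s²+d))
              (solve 2 (λ s d → con 2 :* (s :* s) :+ con 4 :* con 2 :* s :+ con 4 :+ con 2 :* (s :* s :+ d) :=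
                                con 4 :* (s :* s) :+ con 4 :* con 2 :* s :+ con 4 :+ con 2 :* d) refl s d))

      module Down (2<s² : 2# < s * s) where
        d = proj₁ (gap 2<s²)
        0<d = proj₁ (proj₂ (gap 2<s²))
        s²≈2+d = proj₂ (proj₂ (gap 2<s²))

        t<s : t < s
        t<s = ungap (*-pos 0<d 0<w)
          (trans s≈
            (trans (solve 2 (λ s w → s :* ((s :+ con 2) :* w) := (con 2 :* s :+ s :* s) :* w) refl s w)
            (trans (*-congʳ (+-congˡ s²≈2+d))
                   (solve 3 (λ s d w → (con 2 :* s :+ (con 2 :+ d)) :* w :=
                                       (con 2 :* s :+ con 2) :* w :+ d :* w) refl s d w))))

        2<t² : 2# < t * t
        2<t² = ungap (*-pos 0<2 (*-pos 0<d (*-pos 0<w 0<w)))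
          (trans (solve 2 (λ s w → ((con 2 :* s :+ con 2) :* w) :* ((con 2 :* s :+ con 2) :* w) :=
                                   (con 2 :* (s :* s) :+ con 4 :* con 2 :* s :+ con 4 :+ con 2 :* (s :* s)) :* (w :* w))
                          refl s w)
            (trans (*-congʳ (+-congˡ (*-congˡ s²≈2+d)))
            (trans (solve 3 (λ s d w → (con 2 :* (s :* s) :+ con 4 :* con 2 :* s :+ con 4 :+ con 2 :* (con 2 :+ d)) :* (w :* w) :=
                                       con 2 :* (((s :+ con 2) :* w) :* ((s :+ con 2) :* w)) :+ con 2 :* (d :* (w :* w)))
                            refl s d w)
                   (+-congʳ (sym 2≈)))))

  abstract
    √2-exists : ∃[ s ] (0# < s × s * s ≈ 2#)
    √2-exists with complete below (1# , 1∈below) (2# , 2-bound)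
    ... | s , upper , least = s , 0<s , s²≈2
      where
      0<s : 0# < s
      0<s with upper 1∈below
      ... | inj₁ 1<s = <-trans 0<1 1<s
      ... | inj₂ 1≈s = respʳ 1≈s 0<1

      open Step s 0<s

      t-bound : 2# < t * t → IsUpperBound below t
      t-bound 2<t² {x} (0<x , x²<2) with Order.compare x t
      ... | tri< x<t _ _ = inj₁ x<t
      ... | tri≈ _ x≈t _ = inj₂ x≈t
      ... | tri> _ _ t<x = contradiction (<-trans x²<2 2<t²) (asym (sq-mono-< 0<t t<x))

      s²≈2 : s * s ≈ 2#
      s²≈2 with Order.compare (s * s) 2#
      ... | tri≈ _ eq _   = eq
      ... | tri< s²<2 _ _ = contradiction (Up.s<t s²<2) (≤⇒≯ (upper (0<t , Up.t²<2 s²<2)))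
      ... | tri> _ _ 2<s² = contradiction (Down.t<s 2<s²) (≤⇒≯ (least (t-bound (Down.2<t² 2<s²))))

  √2 : ℝ
  √2 = proj₁ √2-exists

  0<√2 : 0# < √2
  0<√2 = proj₁ (proj₂ √2-exists)

  √2*√2≈2 : √2 * √2 ≈ 2#
  √2*√2≈2 = proj₂ (proj₂ √2-exists)

data Generated (G : Group 0ℓ 0ℓ) (S : Pred (Group.Carrier G) 0ℓ) : Pred (Group.Carrier G) 0ℓ where
  generator : ∀ {g}   → g ∈ S → g ∈ Generated G S
  identity  : Group.ε G ∈ Generated G S
  product   : ∀ {g h} → g ∈ Generated G S → h ∈ Generated G S → Group._∙_ G g h ∈ Generated G S
  inverse   : ∀ {g}   → g ∈ Generated G S → Group._⁻¹ G g ∈ Generated G S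
  resp      : ∀ {g h} → Group._≈_ G g h → g ∈ Generated G S → h ∈ Generated G S

module ProjectiveSpecialLinear (K : CommutativeRing 0ℓ 0ℓ) where
  open CommutativeRing K
  open RingProperties ring
  open CommutativeSemigroupProperties *-commutativeSemigroup using (interchange)
  open CommutativeSemigroupProperties +-commutativeSemigroup using ()
    renaming (interchange to +-interchange)
  open SetoidReasoning setoid
  private
    module S = NatSolver commutativeSemiring
  open S using (solve; _:=_; _:+_; _:*_; con)

  -- The matrix (a b ; c d).
  record SL₂ : Set where
    constructor mat
    field
      a b c d : Carrier
      det     : a * d - b * c ≈ 1#
  open SL₂

  infix 4 _≐_ _≋_

  record _≐_ (A B : SL₂) : Set where
    constructor entries
    field
      a≈ : a A ≈ a B
      b≈ : b A ≈ b B
      c≈ : c A ≈ c B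
      d≈ : d A ≈ d B

  private
    det⁻ : ∀ {x y} → x - y ≈ 1# → x ≈ 1# + y
    det⁻ {x} {y} e = begin
      x              ≈⟨ +-identityʳ x ⟨
      x + 0#         ≈⟨ +-congˡ (-‿inverseˡ y) ⟨
      x + (- y + y)  ≈⟨ +-assoc x (- y) y ⟨
      x - y + y      ≈⟨ +-congʳ e ⟩
      1# + y         ∎

    det⁺ : ∀ {x y} → x ≈ 1# + y → x - y ≈ 1#
    det⁺ {x} {y} e = begin
      x - y         ≈⟨ +-congʳ e ⟩
      1# + y - y    ≈⟨ +-assoc 1# y (- y) ⟩
      1# + (y - y)  ≈⟨ +-congˡ (-‿inverseʳ y) ⟩
      1# + 0#       ≈⟨ +-identityʳ 1# ⟩
      1#            ∎

    neg-neg : ∀ x y → - x * - y ≈ x * y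
    neg-neg x y = begin
      - x * - y    ≈⟨ -‿distribˡ-* x (- y) ⟨
      - (x * - y)  ≈⟨ -‿cong (-‿distribʳ-* x y) ⟨
      - - (x * y)  ≈⟨ -‿involutive (x * y) ⟩
      x * y        ∎

    abstract
      det-∙ : ∀ a b c d a' b' c' d' → a * d ≈ 1# + b * c → a' * d' ≈ 1# + b' * c' →
              (a * a' + b * c') * (c * b' + d * d') ≈ 1# + (a * b' + b * d') * (c * a' + d * c')
      det-∙ a b c d a' b' c' d' e e' = begin
        (a * a' + b * c') * (c * b' + d * d')
          ≈⟨ foil (a * a') (b * c') (c * b') (d * d') ⟩
        (a * a') * (c * b') + (a * a') * (d * d') + (b * c') * (c * b') + (b * c') * (d * d')
          ≈⟨ +-cong (+-cong (+-cong (interchange a a' c b') (interchange a a' d d'))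
                            (trans (interchange b c' c b') (*-congˡ (*-comm c' b'))))
                    (interchange b c' d d') ⟩
        (a * c) * (a' * b') + (a * d) * (a' * d') + (b * c) * (b' * c') + (b * d) * (c' * d')
          ≈⟨ +-congʳ (+-congʳ (+-congˡ (*-cong e e'))) ⟩
        (a * c) * (a' * b') + (1# + b * c) * (1# + b' * c') + (b * c) * (b' * c') + (b * d) * (c' * d')
          ≈⟨ solve 4 (λ u x y v →
               u :+ (con 1 :+ x) :* (con 1 :+ y) :+ x :* y :+ v :=
               con 1 :+ (u :+ (con 1 :+ x) :* y :+ x :* (con 1 :+ y) :+ v))
               refl ((a * c) * (a' * b')) (b * c) (b' * c') ((b * d) * (c' * d')) ⟩
        1# + ((a * c) * (a' * b') + (1# + b * c) * (b' * c') + (b * c) * (1# + b' * c') + (b * d) * (c' * d'))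
          ≈⟨ +-congˡ (+-congʳ (+-cong (+-congˡ (*-congʳ e)) (*-congˡ e'))) ⟨
        1# + ((a * c) * (a' * b') + (a * d) * (b' * c') + (b * c) * (a' * d') + (b * d) * (c' * d'))
          ≈⟨ +-congˡ (+-cong (+-cong (+-cong (trans (interchange a b' c a') (*-congˡ (*-comm b' a')))
                                             (interchange a b' d c'))
                                     (trans (interchange b d' c a') (*-congˡ (*-comm d' a'))))
                             (trans (interchange b d' d c') (*-congˡ (*-comm d' c')))) ⟨
        1# + ((a * b') * (c * a') + (a * b') * (d * c') + (b * d') * (c * a') + (b * d') * (d * c'))
          ≈⟨ +-congˡ (foil (a * b') (b * d') (c * a') (d * c')) ⟨
        1# + (a * b' + b * d') * (c * a' + d * c') ∎
        where
        foil : ∀ x y z w → (x + y) * (z + w) ≈ x * z + x * w + y * z + y * w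
        foil = solve 4 (λ x y z w →
          (x :+ y) :* (z :+ w) := x :* z :+ x :* w :+ y :* z :+ y :* w) refl

  infixl 7 _∙_
  infix 8 _⁻¹

  _∙_ : SL₂ → SL₂ → SL₂
  mat a b c d e ∙ mat a' b' c' d' e' =
    mat (a * a' + b * c') (a * b' + b * d') (c * a' + d * c') (c * b' + d * d')
        (det⁺ (det-∙ a b c d a' b' c' d' (det⁻ e) (det⁻ e')))

  I : SL₂
  I = mat 1# 0# 0# 1#
    (det⁺ (trans (*-identityʳ 1#) (sym (trans (+-congˡ (zeroʳ 0#)) (+-identityʳ 1#)))))

  _⁻¹ : SL₂ → SL₂
  mat a b c d e ⁻¹ = mat d (- b) (- c) a
    (trans (+-cong (*-comm d a) (-‿cong (neg-neg b c))) e)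

  neg : SL₂ → SL₂
  neg (mat a b c d e) = mat (- a) (- b) (- c) (- d)
    (trans (+-cong (neg-neg a d) (-‿cong (neg-neg b c))) e)

  _≋_ : Rel SL₂ 0ℓ
  A ≋ B = A ≐ B ⊎ A ≐ neg B

  private
    ≐-refl : ∀ {A} → A ≐ A
    ≐-refl = entries refl refl refl refl

    ≐-sym : ∀ {A B} → A ≐ B → B ≐ A
    ≐-sym (entries p q r s) = entries (sym p) (sym q) (sym r) (sym s)

    ≐-trans : ∀ {A B C} → A ≐ B → B ≐ C → A ≐ C
    ≐-trans (entries p q r s) (entries p' q' r' s') =
      entries (trans p p') (trans q q') (trans r r') (trans s s')

    neg-cong : ∀ {A B} → A ≐ B → neg A ≐ neg B
    neg-cong (entries p q r s) = entries (-‿cong p) (-‿cong q) (-‿cong r) (-‿cong s)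

    neg-invol : ∀ A → neg (neg A) ≐ A
    neg-invol (mat a b c d _) =
      entries (-‿involutive a) (-‿involutive b) (-‿involutive c) (-‿involutive d)

    ∙-cong≐ : ∀ {A A' B B'} → A ≐ A' → B ≐ B' → A ∙ B ≐ A' ∙ B'
    ∙-cong≐ (entries p q r s) (entries p' q' r' s') = entries
      (+-cong (*-cong p p') (*-cong q r')) (+-cong (*-cong p q') (*-cong q s'))
      (+-cong (*-cong r p') (*-cong s r')) (+-cong (*-cong r q') (*-cong s s'))

    inv-cong≐ : ∀ {A B} → A ≐ B → A ⁻¹ ≐ B ⁻¹
    inv-cong≐ (entries p q r s) = entries s (-‿cong q) (-‿cong r) p

    negˡ : ∀ x y z w → - x * y + - z * w ≈ - (x * y + z * w)
    negˡ x y z w = trans (sym (+-cong (-‿distribˡ-* x y) (-‿distribˡ-* z w))) (-‿+-comm _ _)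

    negʳ : ∀ x y z w → x * - y + z * - w ≈ - (x * y + z * w)
    negʳ x y z w = trans (sym (+-cong (-‿distribʳ-* x y) (-‿distribʳ-* z w))) (-‿+-comm _ _)

    neg-∙ˡ : ∀ A B → neg A ∙ B ≐ neg (A ∙ B)
    neg-∙ˡ (mat a b c d _) (mat a' b' c' d' _) =
      entries (negˡ a a' b c') (negˡ a b' b d') (negˡ c a' d c') (negˡ c b' d d')

    neg-∙ʳ : ∀ A B → A ∙ neg B ≐ neg (A ∙ B)
    neg-∙ʳ (mat a b c d _) (mat a' b' c' d' _) =
      entries (negʳ a a' b c') (negʳ a b' b d') (negʳ c a' d c') (negʳ c b' d d')

    ≋-sym : ∀ {A B} → A ≋ B → B ≋ A
    ≋-sym (inj₁ p) = inj₁ (≐-sym p)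
    ≋-sym {A} {B} (inj₂ p) = inj₂ (≐-trans (≐-sym (neg-invol B)) (neg-cong (≐-sym p)))

    ≋-trans : ∀ {A B C} → A ≋ B → B ≋ C → A ≋ C
    ≋-trans (inj₁ p) (inj₁ q) = inj₁ (≐-trans p q)
    ≋-trans (inj₁ p) (inj₂ q) = inj₂ (≐-trans p q)
    ≋-trans (inj₂ p) (inj₁ q) = inj₂ (≐-trans p (neg-cong q))
    ≋-trans {C = C} (inj₂ p) (inj₂ q) = inj₁ (≐-trans p (≐-trans (neg-cong q) (neg-invol C)))

    ∙-cong : ∀ {A A' B B'} → A ≋ A' → B ≋ B' → A ∙ B ≋ A' ∙ B'
    ∙-cong {A} {A'} {B} {B'} (inj₁ p) (inj₁ q) = inj₁ (∙-cong≐ {A} {A'} {B} {B'} p q)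
    ∙-cong {A} {A'} {B} {B'} (inj₁ p) (inj₂ q) = inj₂
      (≐-trans {A ∙ B} {A' ∙ neg B'} (∙-cong≐ {A} {A'} {B} {neg B'} p q) (neg-∙ʳ A' B'))
    ∙-cong {A} {A'} {B} {B'} (inj₂ p) (inj₁ q) = inj₂
      (≐-trans {A ∙ B} {neg A' ∙ B'} (∙-cong≐ {A} {neg A'} {B} {B'} p q) (neg-∙ˡ A' B'))
    ∙-cong {A} {A'} {B} {B'} (inj₂ p) (inj₂ q) = inj₁
      (≐-trans {A ∙ B} {neg A' ∙ neg B'} (∙-cong≐ {A} {neg A'} {B} {neg B'} p q)
      (≐-trans {neg A' ∙ neg B'} {neg (A' ∙ neg B')} (neg-∙ˡ A' (neg B'))
      (≐-trans {neg (A' ∙ neg B')} {neg (neg (A' ∙ B'))}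
        (neg-cong {A' ∙ neg B'} {neg (A' ∙ B')} (neg-∙ʳ A' B')) (neg-invol (A' ∙ B')))))

    inv-cong : ∀ {A B} → A ≋ B → A ⁻¹ ≋ B ⁻¹
    inv-cong {A} {B} (inj₁ p) = inj₁ (inv-cong≐ {A} {B} p)
    inv-cong (inj₂ (entries p q r s)) = inj₂ (entries s (-‿cong q) (-‿cong r) p)

    ∙-assoc : ∀ A B C → (A ∙ B) ∙ C ≐ A ∙ (B ∙ C)
    ∙-assoc (mat a b c d _) (mat a' b' c' d' _) (mat a'' b'' c'' d'' _) =
      entries (entry a b a'' c'') (entry a b b'' d'') (entry c d a'' c'') (entry c d b'' d'')
      where
      entry : ∀ x y z w → (x * a' + y * c') * z + (x * b' + y * d') * w
                        ≈ x * (a' * z + b' * w) + y * (c' * z + d' * w)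
      entry x y z w = begin
        (x * a' + y * c') * z + (x * b' + y * d') * w
          ≈⟨ +-cong (row x y a' c' z) (row x y b' d' w) ⟩
        (x * (a' * z) + y * (c' * z)) + (x * (b' * w) + y * (d' * w))
          ≈⟨ +-interchange _ _ _ _ ⟩
        (x * (a' * z) + x * (b' * w)) + (y * (c' * z) + y * (d' * w))
          ≈⟨ +-cong (distribˡ x _ _) (distribˡ y _ _) ⟨
        x * (a' * z + b' * w) + y * (c' * z + d' * w) ∎
        where
        row : ∀ x y u v z → (x * u + y * v) * z ≈ x * (u * z) + y * (v * z)
        row x y u v z = trans (distribʳ z _ _) (+-cong (*-assoc x u z) (*-assoc y v z))

    ∙-identityˡ : ∀ A → I ∙ A ≐ A
    ∙-identityˡ (mat a b c d _) = entries (l a c) (l b d) (r a c) (r b d)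
      where
      l : ∀ x y → 1# * x + 0# * y ≈ x
      l = solve 2 (λ x y → con 1 :* x :+ con 0 :* y := x) refl
      r : ∀ x y → 0# * x + 1# * y ≈ y
      r = solve 2 (λ x y → con 0 :* x :+ con 1 :* y := y) refl

    ∙-identityʳ : ∀ A → A ∙ I ≐ A
    ∙-identityʳ (mat a b c d _) = entries (l a b) (r a b) (l c d) (r c d)
      where
      l : ∀ x y → x * 1# + y * 0# ≈ x
      l = solve 2 (λ x y → x :* con 1 :+ y :* con 0 := x) refl
      r : ∀ x y → x * 0# + y * 1# ≈ y
      r = solve 2 (λ x y → x :* con 0 :+ y :* con 1 := y) refl

    ∙-inverseʳ : ∀ A → A ∙ A ⁻¹ ≐ I
    ∙-inverseʳ (mat a b c d e) = entries
      (trans (+-congˡ (sym (-‿distribʳ-* b c))) e)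
      (trans (+-congʳ (trans (sym (-‿distribʳ-* a b)) (-‿cong (*-comm a b)))) (-‿inverseˡ _))
      (trans (+-congˡ (trans (sym (-‿distribʳ-* d c)) (-‿cong (*-comm d c)))) (-‿inverseʳ _))
      (trans (+-congʳ (trans (sym (-‿distribʳ-* c b)) (-‿cong (*-comm c b))))
        (trans (+-comm _ _) (trans (+-congʳ (*-comm d a)) e)))

    inv-invol : ∀ A → A ⁻¹ ⁻¹ ≐ A
    inv-invol (mat a b c d _) = entries refl (-‿involutive b) (-‿involutive c) refl

    ∙-inverseˡ : ∀ A → A ⁻¹ ∙ A ≐ I
    ∙-inverseˡ A = ≐-trans {A ⁻¹ ∙ A} {A ⁻¹ ∙ A ⁻¹ ⁻¹}
      (∙-cong≐ {A ⁻¹} {A ⁻¹} {A} {A ⁻¹ ⁻¹} (≐-refl {A ⁻¹}) (≐-sym {A ⁻¹ ⁻¹} {A} (inv-invol A))) (∙-inverseʳ (A ⁻¹))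

  -- Matrices of determinant 1 with A identified with -A.
  PSL₂ : Group 0ℓ 0ℓ
  PSL₂ = record
    { Carrier = SL₂
    ; _≈_     = _≋_
    ; _∙_     = _∙_
    ; ε       = I
    ; _⁻¹     = _⁻¹
    ; isGroup = record
      { isMonoid = record
        { isSemigroup = record
          { isMagma = record
            { isEquivalence = record { refl = λ {A} → inj₁ (≐-refl {A}) ; sym = ≋-sym ; trans = ≋-trans }
            ; ∙-cong        = ∙-cong
            }
          ; assoc = λ A B C → inj₁ (∙-assoc A B C)
          }
        ; identity = (λ A → inj₁ (∙-identityˡ A)) , (λ A → inj₁ (∙-identityʳ A))
        }
      ; inverse = (λ A → inj₁ (∙-inverseˡ A)) , (λ A → inj₁ (∙-inverseʳ A))
      ; ⁻¹-cong = inv-cong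
      }
    }

module Hecke (em : ExcludedMiddle 0ℓ) (R : CompleteOrderedField) where
  open CompleteOrderedField R public
  open SquareRoot R public using (√2; 0<√2; √2*√2≈2)
  open ProjectiveSpecialLinear commutativeRing public using (SL₂; mat; PSL₂; _≋_)
  open ExtremaEquality _≈_ public using (_≈±_)
  open RingProperties ring using (-0#≈0#; -‿involutive)

  translation : SL₂
  translation = mat 1# √2 0# 1#
    (trans (+-cong (*-identityʳ 1#) (trans (-‿cong (zeroʳ √2)) -0#≈0#)) (+-identityʳ 1#))

  inversion : SL₂
  inversion = mat 0# (- 1#) 1# 0#
    (trans (+-cong (zeroʳ 0#) (trans (-‿cong (*-identityʳ (- 1#))) (-‿involutive 1#)))
           (+-identityˡ 1#))

  data HeckeGenerator : Pred SL₂ 0ℓ where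
    isTranslation : translation ∈ HeckeGenerator
    isInversion   : inversion ∈ HeckeGenerator

  H₄ : Pred SL₂ 0ℓ
  H₄ = Generated PSL₂ HeckeGenerator

  -- The finite elements of ℚ(H₄).
  ℚ[H₄] : Pred ℝ 0ℓ
  ℚ[H₄] x = ∃[ M ] (M ∈ H₄ × SL₂.c M ≉ 0# × x ≈ SL₂.a M / SL₂.c M)

  -- A finite element p/q of ℚ(H₄) in normalized form, with a witnessing matrix.
  record Fraction : Set where
    field
      matrix   : SL₂
      matrix∈  : matrix ∈ H₄
      positive : 0# < SL₂.c matrix

    p q : ℝ
    p = SL₂.a matrix
    q = SL₂.c matrix

    value : ℝ
    value = p / q

  open Fraction public using (p; q; value)

  error : ℝ → Fraction → ℝ
  error α x = ∣ q x * α - p x ∣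

  IsBestApproximation : ℝ → Pred Fraction 0ℓ
  IsBestApproximation α x =
    ∀ (y : Fraction) → value y ≉ value x → q y ≤ q x → error α x < error α y

  -- The sequence is indexed from 0; x 0 is the first best approximation.
  record IsBestApproximationSequence (α : ℝ) (x : ℕ → Fraction) : Set where
    field
      best       : ∀ i → IsBestApproximation α (x i)
      exhaustive : ∀ y → IsBestApproximation α y → ∃[ i ] value (x i) ≈ value y
      increasing : ∀ i → q (x i) < q (x (ℕ.suc i))

  -- The infimum in ℝ ∪ {±∞}, so that the empty set has infimum ⊤± = +∞.
  inf : Pred ℝ 0ℓ → ℝ ±
  inf S with em {∃ S} | em {∃ (IsLowerBound S)}
  ... | no _         | _           = ⊤±
  ... | yes _        | no _        = ⊥±
  ... | yes nonempty | yes bounded = [ proj₁ (infimum S nonempty bounded) ]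

  -- inf over n of sup {u k | k ≥ n}.  The tails are nonempty, so a tail without
  -- a supremum in ℝ has supremum +∞ and may be left out of the infimum.
  limsup : (ℕ → ℝ) → ℝ ±
  limsup u = inf λ s → ∃[ n ] IsSupremum (λ y → ∃[ k ] (n ℕ.≤ k × y ≈ u k)) s

  K : ℝ → ℝ ±
  K α = inf λ κ → 0# < κ × (∃[ N₀ ] ∀ N → N₀ ≤ N →
          ∃[ x ] (error α x < κ / N × 1# ≤ q x × q x ≤ N))

{-# OPTIONS --safe #-}

-- Only finitely many fractions have bounded denominator and bounded error, and a tie between two
-- fractions with equal denominators would put α, their midpoint, into √2ℚ = ℚ(H₄).  Hence below every
-- fraction there is a best approximation that is at least as good, so x i minimizes the error among
-- all fractions with denominator below q (x (i+1)).  If κ is admissible for K(α), letting N approach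
-- q (x (i+1)) from below gives q (x (i+1)) * error (x i) ≤ κ for large i; conversely the supremum of a
-- tail of this sequence is itself admissible, with x i serving all N in [q (x i), q (x (i+1))).
module Submission where

open import Level using (0ℓ)
open import Axiom.ExcludedMiddle using (ExcludedMiddle)
open import Relation.Nullary using (¬_; yes; no; contradiction)
open import Relation.Unary using (Pred; _∈_)
open import Algebra.Bundles using (CommutativeRing)
open import Algebra.Bundles.Raw using (RawRing)
open import Algebra.Solver.Ring.AlmostCommutativeRing
  using (fromCommutativeRing; _-Raw-AlmostCommutative⟶_)
open import Data.Bool.Base using (Bool; true; false; not; _xor_)
open import Data.Integer.Base as ℤ using (ℤ; -[1+_]) renaming (+_ to pos)
open import Data.List.Base using (List; []; _∷_; _++_; map; upTo; cartesianProduct)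
open import Data.List.Membership.Propositional using () renaming (_∈_ to _∈ₗ_)
open import Data.List.Membership.Propositional.Properties
  using (∈-++⁺ˡ; ∈-++⁺ʳ; ∈-map⁺; ∈-upTo⁺; ∈-cartesianProduct⁺)
open import Data.List.Relation.Unary.Any using (here; there)
open import Data.Maybe.Base using (Maybe; just; nothing)
open import Data.Nat.Base as ℕ using (ℕ; zero; suc)
open import Data.Nat.Divisibility using (divides)
open import Data.Nat.Induction using (<-wellFounded)
open import Data.Nat.Primality using (euclidsLemma; prime[2])
open import Data.Product.Base using (∃; ∃-syntax; _×_; _,_; proj₁; proj₂)
open import Data.Sum.Base using (_⊎_; inj₁; inj₂; reduce)
open import Induction.WellFounded using (Acc; acc)
open import Relation.Binary.Bundles using (StrictPartialOrder)
open import Relation.Binary.Core using (Rel)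
open import Relation.Binary.Definitions using (Total; Transitive; Tri; tri<; tri≈; tri>)
open import Relation.Binary.PropositionalEquality as ≡ using (_≡_)
import Algebra.Properties.Ring as RingProperties
import Algebra.Properties.Semiring.Mult.TCOptimised as SemiringMult
import Algebra.Solver.Ring as RingSolver
import Data.Integer.Properties as ℤ
import Data.Nat.Properties as ℕ
import Relation.Binary.Construct.Add.Extrema.Equality as ExtremaEquality
import Relation.Binary.Construct.StrictToNonStrict as StrictToNonStrict
import Relation.Binary.Reasoning.Setoid as SetoidReasoning
import Relation.Binary.Reasoning.StrictPartialOrder as StrictReasoning
open import Defs

-- The group is given by generators only, so its arithmetic has to be extracted in both directions.
-- An invariant carried along words shows that the entries of a matrix are integers times 1 or √2 in
-- a checkerboard pattern. Hence numerators and denominators have integral squares, which yields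
-- finiteness and unbounded denominators, and by the irrationality of √2 equal denominators go with
-- numerators of the same kind. Conversely, a Euclidean algorithm places all of √2ℚ in ℚ(H₄), which
-- is what excludes ties. The given sequence meets other best approximations by value only, so the
-- normalized pair has to be recovered from the value. Finally, K(α) and the limsup are infima of
-- two different sets, one contained in the other and reaching below each of its elements; this also
-- settles the value +∞, where both sets are empty.

-- Integers in a commutative ring

module IntegerEmbedding (A : CommutativeRing 0ℓ 0ℓ) where
  open CommutativeRing A
  open RingProperties ring
  open SemiringMult semiring renaming (_×_ to _×#_)
  open SetoidReasoning setoid

  ⟦_⟧ : ℤ → Carrier
  ⟦ pos n ⟧    = n ×# 1#
  ⟦ -[1+ n ] ⟧ = - (suc n ×# 1#)

  ⟦⊖⟧ : ∀ m n → ⟦ m ℤ.⊖ n ⟧ ≈ m ×# 1# - n ×# 1#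
  ⟦⊖⟧ zero    zero    = sym (-‿inverseʳ 0#)
  ⟦⊖⟧ zero    (suc n) = sym (+-identityˡ _)
  ⟦⊖⟧ (suc m) zero    = sym (trans (+-congˡ -0#≈0#) (+-identityʳ _))
  ⟦⊖⟧ (suc m) (suc n) = begin
    ⟦ suc m ℤ.⊖ suc n ⟧                ≡⟨ ≡.cong ⟦_⟧ (ℤ.[1+m]⊖[1+n]≡m⊖n m n) ⟩
    ⟦ m ℤ.⊖ n ⟧                        ≈⟨ ⟦⊖⟧ m n ⟩
    m ×# 1# - n ×# 1#                  ≈⟨ +-congʳ (+-identityʳ _) ⟨
    m ×# 1# + 0# - n ×# 1#             ≈⟨ +-congʳ (+-congˡ (-‿inverseʳ 1#)) ⟨
    m ×# 1# + (1# - 1#) - n ×# 1#      ≈⟨ +-congʳ (+-assoc _ _ _) ⟨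
    m ×# 1# + 1# - 1# - n ×# 1#        ≈⟨ +-assoc _ _ _ ⟩
    m ×# 1# + 1# + (- 1# - n ×# 1#)    ≈⟨ +-cong (+-comm _ _) (-‿+-comm _ _) ⟩
    1# + m ×# 1# - (1# + n ×# 1#)      ≈⟨ +-cong (1+× m 1#) (-‿cong (1+× n 1#)) ⟨
    suc m ×# 1# - suc n ×# 1#          ∎

  ⟦+⟧ : ∀ i j → ⟦ i ℤ.+ j ⟧ ≈ ⟦ i ⟧ + ⟦ j ⟧
  ⟦+⟧ (pos m)  (pos n)  = ×-homo-+ 1# m n
  ⟦+⟧ (pos m)  -[1+ n ] = ⟦⊖⟧ m (suc n)
  ⟦+⟧ -[1+ m ] (pos n)  = trans (⟦⊖⟧ n (suc m)) (+-comm _ _)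
  ⟦+⟧ -[1+ m ] -[1+ n ] = begin
    - (suc (suc (m ℕ.+ n)) ×# 1#)      ≡⟨ ≡.cong (λ k → - (k ×# 1#)) (≡.cong suc (ℕ.+-suc m n)) ⟨
    - ((suc m ℕ.+ suc n) ×# 1#)        ≈⟨ -‿cong (×-homo-+ 1# (suc m) (suc n)) ⟩
    - (suc m ×# 1# + suc n ×# 1#)      ≈⟨ -‿+-comm _ _ ⟨
    - (suc m ×# 1#) - suc n ×# 1#      ∎

  ⟦-⟧ : ∀ i → ⟦ ℤ.- i ⟧ ≈ - ⟦ i ⟧
  ⟦-⟧ (pos zero)    = sym -0#≈0#
  ⟦-⟧ (pos (suc n)) = refl
  ⟦-⟧ -[1+ n ]      = sym (-‿involutive _)

  private
    ⟦pos*⟧ : ∀ m j → ⟦ pos m ℤ.* j ⟧ ≈ (m ×# 1#) * ⟦ j ⟧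
    ⟦pos*⟧ m (pos n)  = trans (reflexive (≡.cong ⟦_⟧ (≡.sym (ℤ.pos-* m n)))) (×1-homo-* m n)
    ⟦pos*⟧ m -[1+ n ] = begin
      ⟦ pos m ℤ.* -[1+ n ] ⟧             ≡⟨ ≡.cong ⟦_⟧ (ℤ.neg-distribʳ-* (pos m) (pos (suc n))) ⟨
      ⟦ ℤ.- (pos m ℤ.* pos (suc n)) ⟧    ≈⟨ ⟦-⟧ (pos m ℤ.* pos (suc n)) ⟩
      - ⟦ pos m ℤ.* pos (suc n) ⟧        ≈⟨ -‿cong (⟦pos*⟧ m (pos (suc n))) ⟩
      - ((m ×# 1#) * (suc n ×# 1#))      ≈⟨ -‿distribʳ-* _ _ ⟩
      (m ×# 1#) * - (suc n ×# 1#)        ∎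

  ⟦*⟧ : ∀ i j → ⟦ i ℤ.* j ⟧ ≈ ⟦ i ⟧ * ⟦ j ⟧
  ⟦*⟧ (pos m)  j = ⟦pos*⟧ m j
  ⟦*⟧ -[1+ m ] j = begin
    ⟦ -[1+ m ] ℤ.* j ⟧              ≡⟨ ≡.cong ⟦_⟧ (ℤ.neg-distribˡ-* (pos (suc m)) j) ⟨
    ⟦ ℤ.- (pos (suc m) ℤ.* j) ⟧     ≈⟨ ⟦-⟧ (pos (suc m) ℤ.* j) ⟩
    - ⟦ pos (suc m) ℤ.* j ⟧         ≈⟨ -‿cong (⟦pos*⟧ (suc m) j) ⟩
    - ((suc m ×# 1#) * ⟦ j ⟧)       ≈⟨ -‿distribˡ-* _ _ ⟩
    - (suc m ×# 1#) * ⟦ j ⟧         ∎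

  private
    ℤ-rawRing : RawRing 0ℓ 0ℓ
    ℤ-rawRing = record
      { Carrier = ℤ ; _≈_ = _≡_ ; _+_ = ℤ._+_ ; _*_ = ℤ._*_ ; -_ = ℤ.-_ ; 0# = ℤ.0ℤ ; 1# = ℤ.1ℤ }

    morphism : ℤ-rawRing -Raw-AlmostCommutative⟶ fromCommutativeRing A
    morphism = record
      { ⟦_⟧ = ⟦_⟧ ; +-homo = ⟦+⟧ ; *-homo = ⟦*⟧ ; -‿homo = ⟦-⟧ ; 0-homo = refl ; 1-homo = refl }

    _≟_ : ∀ i j → Maybe (⟦ i ⟧ ≈ ⟦ j ⟧)
    i ≟ j with i ℤ.≟ j
    ... | yes i≡j = just (reflexive (≡.cong ⟦_⟧ i≡j))
    ... | no _    = nothing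

  -- Cancelling opposite terms requires decidable coefficients. Equality in `A` is not assumed
  -- decidable, so the coefficients are integers.
  module Solver = RingSolver ℤ-rawRing (fromCommutativeRing A) morphism _≟_

-- Order, absolute value and the Archimedean property

module RealProperties (R : CompleteOrderedField) where
  open CompleteOrderedField R
  open IntegerEmbedding commutativeRing public
  open RingProperties ring using (-0#≈0#; -‿involutive)
  open Solver using (solve; _:=_; _:+_; _:*_; _:-_; :-_; con)
  open SemiringMult semiring using (1+×)

  strictPartialOrder : StrictPartialOrder 0ℓ 0ℓ 0ℓ
  strictPartialOrder = record { isStrictPartialOrder = Order.isStrictPartialOrder }

  module ≤-Reasoning = StrictReasoning strictPartialOrder

  private
    module NonStrict = StrictToNonStrict _≈_ _<_

  <-≤-trans : ∀ {x y z} → x < y → y ≤ z → x < z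
  <-≤-trans = NonStrict.<-≤-trans Order.trans Order.<-respʳ-≈

  ≤-<-trans : ∀ {x y z} → x ≤ y → y < z → x < z
  ≤-<-trans = NonStrict.≤-<-trans sym Order.trans Order.<-respˡ-≈

  ≤-trans : ∀ {x y z} → x ≤ y → y ≤ z → x ≤ z
  ≤-trans = NonStrict.trans isEquivalence Order.<-resp-≈ Order.trans

  ≤-antisym : ∀ {x y} → x ≤ y → y ≤ x → x ≈ y
  ≤-antisym = NonStrict.antisym isEquivalence Order.trans Order.irrefl

  ≤-total : ∀ x y → x ≤ y ⊎ y ≤ x
  ≤-total = NonStrict.total Order.compare

  <⇒≱ : ∀ {x y} → x < y → ¬ (y ≤ x)
  <⇒≱ x<y y≤x = Order.irrefl refl (<-≤-trans x<y y≤x)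

  ≮⇒≥ : ∀ {x y} → ¬ (x < y) → y ≤ x
  ≮⇒≥ {x} {y} x≮y with Order.compare x y
  ... | tri< x<y _ _ = contradiction x<y x≮y
  ... | tri≈ _ x≈y _ = inj₂ (sym x≈y)
  ... | tri> _ _ y<x = inj₁ y<x

  >⇒≉ : ∀ {x y} → y < x → x ≉ y
  >⇒≉ y<x x≈y = Order.irrefl (sym x≈y) y<x

  +-monoʳ-< : ∀ {x y} z → x < y → z + x < z + y
  +-monoʳ-< z x<y = Order.<-respˡ-≈ (+-comm _ z) (Order.<-respʳ-≈ (+-comm _ z) (+-monoˡ-< z x<y))

  +-monoˡ-≤ : ∀ {x y} z → x ≤ y → x + z ≤ y + z
  +-monoˡ-≤ z (inj₁ x<y) = inj₁ (+-monoˡ-< z x<y)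
  +-monoˡ-≤ z (inj₂ x≈y) = inj₂ (+-congʳ x≈y)

  +-monoʳ-≤ : ∀ {x y} z → x ≤ y → z + x ≤ z + y
  +-monoʳ-≤ z (inj₁ x<y) = inj₁ (+-monoʳ-< z x<y)
  +-monoʳ-≤ z (inj₂ x≈y) = inj₂ (+-congˡ x≈y)

  +-mono-≤ : ∀ {x y z w} → x ≤ y → z ≤ w → x + z ≤ y + w
  +-mono-≤ {y = y} {z} x≤y z≤w = ≤-trans (+-monoˡ-≤ z x≤y) (+-monoʳ-≤ y z≤w)

  +-pos : ∀ {x y} → 0# < x → 0# < y → 0# < x + y
  +-pos {x} {y} 0<x 0<y = Order.trans 0<y (Order.<-respˡ-≈ (+-identityˡ y) (+-monoˡ-< y 0<x))

  pos-difference : ∀ {x y} → x < y → 0# < y - x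
  pos-difference {x} x<y = Order.<-respˡ-≈ (-‿inverseʳ x) (+-monoˡ-< (- x) x<y)

  difference-pos : ∀ {x y} → 0# < y - x → x < y
  difference-pos {x} {y} 0<y-x = begin-strict
    x           ≈⟨ +-identityˡ x ⟨
    0# + x      <⟨ +-monoˡ-< x 0<y-x ⟩
    y - x + x   ≈⟨ solve 2 (λ x y → y :- x :+ x := y) refl x y ⟩
    y           ∎
    where open ≤-Reasoning

  neg-antimono-< : ∀ {x y} → x < y → - y < - x
  neg-antimono-< {x} {y} x<y = difference-pos
    (Order.<-respʳ-≈ (solve 2 (λ x y → y :- x := :- x :- :- y) refl x y) (pos-difference x<y))

  neg-antimono-≤ : ∀ {x y} → x ≤ y → - y ≤ - x
  neg-antimono-≤ (inj₁ x<y) = inj₁ (neg-antimono-< x<y)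
  neg-antimono-≤ (inj₂ x≈y) = inj₂ (-‿cong (sym x≈y))

  neg-pos : ∀ {x} → x < 0# → 0# < - x
  neg-pos {x} x<0 = Order.<-respˡ-≈ -0#≈0# (neg-antimono-< x<0)

  *-monoʳ-< : ∀ {x y z} → 0# < z → x < y → z * x < z * y
  *-monoʳ-< {x} {y} {z} 0<z x<y = difference-pos
    (Order.<-respʳ-≈ (solve 3 (λ x y z → z :* (y :- x) := z :* y :- z :* x) refl x y z)
                     (*-pos 0<z (pos-difference x<y)))

  *-monoˡ-< : ∀ {x y z} → 0# < z → x < y → x * z < y * z
  *-monoˡ-< {x} {y} {z} 0<z x<y =
    Order.<-respˡ-≈ (*-comm z x) (Order.<-respʳ-≈ (*-comm z y) (*-monoʳ-< 0<z x<y))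

  *-monoʳ-≤ : ∀ {x y z} → 0# < z → x ≤ y → z * x ≤ z * y
  *-monoʳ-≤ 0<z (inj₁ x<y) = inj₁ (*-monoʳ-< 0<z x<y)
  *-monoʳ-≤ 0<z (inj₂ x≈y) = inj₂ (*-congˡ x≈y)

  *-monoˡ-≤ : ∀ {x y z} → 0# < z → x ≤ y → x * z ≤ y * z
  *-monoˡ-≤ 0<z (inj₁ x<y) = inj₁ (*-monoˡ-< 0<z x<y)
  *-monoˡ-≤ 0<z (inj₂ x≈y) = inj₂ (*-congʳ x≈y)

  *-cancelˡ-< : ∀ {x y z} → 0# < z → z * x < z * y → x < y
  *-cancelˡ-< {x} {y} 0<z zx<zy with Order.compare x y
  ... | tri< x<y _ _ = x<y
  ... | tri≈ _ x≈y _ = contradiction zx<zy (Order.irrefl (*-congˡ x≈y))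
  ... | tri> _ _ y<x = contradiction zx<zy (Order.asym (*-monoʳ-< 0<z y<x))

  pos-factor : ∀ {x y} → 0# < x → 0# < x * y → 0# < y
  pos-factor {x} 0<x 0<xy = *-cancelˡ-< 0<x (Order.<-respˡ-≈ (sym (zeroʳ x)) 0<xy)

  *-cancelˡ-≈ : ∀ {x y z} → z ≉ 0# → z * x ≈ z * y → x ≈ y
  *-cancelˡ-≈ {x} {y} {z} z≉0 zx≈zy = begin
    x                 ≈⟨ rearrange x ⟩
    z * x * z ⁻¹      ≈⟨ *-congʳ zx≈zy ⟩
    z * y * z ⁻¹      ≈⟨ rearrange y ⟨
    y                 ∎
    where
    open SetoidReasoning setoid
    rearrange : ∀ w → w ≈ z * w * z ⁻¹
    rearrange w = begin
      w               ≈⟨ *-identityʳ w ⟨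
      w * 1#          ≈⟨ *-congˡ (*-inverseʳ z≉0) ⟨
      w * (z * z ⁻¹)  ≈⟨ solve 3 (λ w z v → w :* (z :* v) := z :* w :* v) refl w z (z ⁻¹) ⟩
      z * w * z ⁻¹    ∎

  /-*-cancel : ∀ {x y} → y ≉ 0# → y * (x / y) ≈ x
  /-*-cancel {x} {y} y≉0 = begin
    y * (x * y ⁻¹)  ≈⟨ solve 3 (λ x y v → y :* (x :* v) := x :* (y :* v)) refl x y (y ⁻¹) ⟩
    x * (y * y ⁻¹)  ≈⟨ *-congˡ (*-inverseʳ y≉0) ⟩
    x * 1#          ≈⟨ *-identityʳ x ⟩
    x               ∎
    where open SetoidReasoning setoid

  -- Replaces the congruence of _⁻¹, which is not among the axioms.
  /-unique : ∀ {x y z} → y ≉ 0# → y * z ≈ x → z ≈ x / y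
  /-unique y≉0 yz≈x = *-cancelˡ-≈ y≉0 (trans yz≈x (sym (/-*-cancel y≉0)))

  -- Denominators may be multiples of √2, but their squares are integers; they are therefore
  -- compared through their squares.
  sq-mono-< : ∀ {x y} → 0# < x → x < y → x * x < y * y
  sq-mono-< 0<x x<y = Order.trans (*-monoʳ-< 0<x x<y) (*-monoˡ-< (Order.trans 0<x x<y) x<y)

  sq-cancel-≤ : ∀ {x y} → 0# < y → x * x ≤ y * y → x ≤ y
  sq-cancel-≤ 0<y xx≤yy = ≮⇒≥ (λ y<x → <⇒≱ (sq-mono-< 0<y y<x) xx≤yy)

  sq-cancel-< : ∀ {x y} → 0# < y → x * x < y * y → x < y
  sq-cancel-< {x} {y} 0<y xx<yy with Order.compare x y
  ... | tri< x<y _ _ = x<y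
  ... | tri≈ _ x≈y _ = contradiction xx<yy (Order.irrefl (*-cong x≈y x≈y))
  ... | tri> _ _ y<x = contradiction xx<yy (Order.asym (sq-mono-< 0<y y<x))

  0≤∣x∣ : ∀ x → 0# ≤ ∣ x ∣
  0≤∣x∣ x with Order.compare x 0#
  ... | tri< x<0 _ _ = inj₁ (neg-pos x<0)
  ... | tri≈ _ x≈0 _ = inj₂ (sym x≈0)
  ... | tri> _ _ 0<x = inj₁ 0<x

  ∣x∣≈±x : ∀ x → ∣ x ∣ ≈ x ⊎ ∣ x ∣ ≈ - x
  ∣x∣≈±x x with Order.compare x 0#
  ... | tri< _ _ _ = inj₂ refl
  ... | tri≈ _ _ _ = inj₁ refl
  ... | tri> _ _ _ = inj₁ refl

  x≤∣x∣ : ∀ x → x ≤ ∣ x ∣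
  x≤∣x∣ x with Order.compare x 0#
  ... | tri< x<0 _ _ = inj₁ (Order.trans x<0 (neg-pos x<0))
  ... | tri≈ _ _ _   = inj₂ refl
  ... | tri> _ _ _   = inj₂ refl

  -x≤∣x∣ : ∀ x → - x ≤ ∣ x ∣
  -x≤∣x∣ x with Order.compare x 0#
  ... | tri< _ _ _   = inj₂ refl
  ... | tri≈ _ x≈0 _ = inj₂ (trans (-‿cong x≈0) (trans -0#≈0# (sym x≈0)))
  ... | tri> _ _ 0<x = inj₁ (difference-pos (Order.<-respʳ-≈
    (solve 1 (λ x → x :+ x := x :- :- x) refl x) (+-pos 0<x 0<x)))

  ∣x∣≤ : ∀ {x b} → x ≤ b → - x ≤ b → ∣ x ∣ ≤ b
  ∣x∣≤ {x} x≤b -x≤b with Order.compare x 0#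
  ... | tri< _ _ _ = -x≤b
  ... | tri≈ _ _ _ = x≤b
  ... | tri> _ _ _ = x≤b

  ∣∣-cong : ∀ {x y} → x ≈ y → ∣ x ∣ ≈ ∣ y ∣
  ∣∣-cong {x} {y} x≈y = ≤-antisym (half x≈y) (half (sym x≈y))
    where
    half : ∀ {x y} → x ≈ y → ∣ x ∣ ≤ ∣ y ∣
    half {x} {y} x≈y =
      ∣x∣≤ (≤-trans (inj₂ x≈y) (x≤∣x∣ y)) (≤-trans (inj₂ (-‿cong x≈y)) (-x≤∣x∣ y))

  ∣x∣≈∣y∣⇒x≈±y : ∀ {x y} → ∣ x ∣ ≈ ∣ y ∣ → x ≈ y ⊎ x ≈ - y
  ∣x∣≈∣y∣⇒x≈±y {x} {y} e with ∣x∣≈±x x | ∣x∣≈±x y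
  ... | inj₁ p | inj₁ q = inj₁ (trans (sym p) (trans e q))
  ... | inj₁ p | inj₂ q = inj₂ (trans (sym p) (trans e q))
  ... | inj₂ p | inj₁ q = inj₂ (trans (sym (-‿involutive x)) (-‿cong (trans (sym p) (trans e q))))
  ... | inj₂ p | inj₂ q = inj₁ (trans (sym (-‿involutive x))
      (trans (-‿cong (trans (sym p) (trans e q))) (-‿involutive y)))

  ∣x∣>0 : ∀ {x} → x ≉ 0# → 0# < ∣ x ∣
  ∣x∣>0 {x} x≉0 with Order.compare x 0#
  ... | tri< x<0 _ _ = neg-pos x<0
  ... | tri≈ _ x≈0 _ = contradiction x≈0 x≉0
  ... | tri> _ _ 0<x = 0<x

  ι : ℕ → ℝ
  ι n = ⟦ pos n ⟧

  ι-suc : ∀ n → ι (suc n) ≈ 1# + ι n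
  ι-suc n = 1+× n 1#

  0<ι : ∀ n → 0# < ι (suc n)
  0<ι zero    = 0<1
  0<ι (suc n) = +-pos (0<ι n) 0<1

  0≤ι : ∀ n → 0# ≤ ι n
  0≤ι zero    = inj₂ refl
  0≤ι (suc n) = inj₁ (0<ι n)

  ι-mono-≤ : ∀ {m n} → m ℕ.≤ n → ι m ≤ ι n
  ι-mono-≤ {n = n} ℕ.z≤n       = 0≤ι n
  ι-mono-≤ {suc m} {suc n} (ℕ.s≤s m≤n) =
    ≤-trans (inj₂ (ι-suc m)) (≤-trans (+-monoʳ-≤ 1# (ι-mono-≤ m≤n)) (inj₂ (sym (ι-suc n))))

  ι-mono-< : ∀ {m n} → m ℕ.< n → ι m < ι n
  ι-mono-< {m} {n} m<n = <-≤-trans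
    (Order.<-respˡ-≈ (+-identityˡ _) (Order.<-respʳ-≈ (sym (ι-suc m)) (+-monoˡ-< (ι m) 0<1)))
    (ι-mono-≤ m<n)

  ι-cancel-< : ∀ {m n} → ι m < ι n → m ℕ.< n
  ι-cancel-< {m} {n} ιm<ιn with m ℕ.<? n
  ... | yes m<n = m<n
  ... | no m≮n  = contradiction (ι-mono-≤ (ℕ.≮⇒≥ m≮n)) (<⇒≱ ιm<ιn)

  ι-injective : ∀ {m n} → ι m ≈ ι n → m ≡ n
  ι-injective {m} {n} e = ℕ.≤-antisym (ℕ.≮⇒≥ (λ n<m → Order.irrefl (sym e) (ι-mono-< n<m)))
                                      (ℕ.≮⇒≥ (λ m<n → Order.irrefl e (ι-mono-< m<n)))

  ⟦⟧-pos : ∀ {i} → 0# < ⟦ i ⟧ → ∃[ n ] i ≡ pos (suc n)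
  ⟦⟧-pos {pos zero}    0<i = contradiction 0<i (Order.irrefl refl)
  ⟦⟧-pos {pos (suc n)} 0<i = n , ≡.refl
  ⟦⟧-pos { -[1+ n ]}   0<i = contradiction 0<i
    (Order.asym (Order.<-respʳ-≈ -0#≈0# (neg-antimono-< (0<ι n))))

  -- If the naturals had a supremum `s`, then `s - 1#` would bound them as well, since every
  -- `ι (suc n)` is at most `s`.
  archimedean : ∀ b → ¬ (∀ n → ι n ≤ b)
  archimedean b bounded with complete (λ x → ∃[ n ] x ≈ ι n) (0# , 0 , refl)
                              (b , λ { (n , x≈ιn) → ≤-trans (inj₂ x≈ιn) (bounded n) })
  ... | s , upper , least = <⇒≱ s-1<s (least s-1-upper)
    where
    open ≤-Reasoning
    s-1<s : s - 1# < s
    s-1<s = difference-pos (Order.<-respʳ-≈ (solve 1 (λ s → con ℤ.1ℤ := s :- (s :- con ℤ.1ℤ)) refl s) 0<1)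
    s-1-upper : IsUpperBound (λ x → ∃[ n ] x ≈ ι n) (s - 1#)
    s-1-upper {x} (n , x≈ιn) = begin
      x                ≈⟨ x≈ιn ⟩
      ι n              ≈⟨ solve 1 (λ x → x := con ℤ.1ℤ :+ x :- con ℤ.1ℤ) refl (ι n) ⟩
      1# + ι n - 1#    ≈⟨ +-congʳ (ι-suc n) ⟨
      ι (suc n) - 1#   ≤⟨ +-monoˡ-≤ (- 1#) (upper (suc n , refl)) ⟩
      s - 1#           ∎

-- Irrationality of √2

-- As 2 is prime, it divides `m`. Cancelling a factor 2 turns the solution `(m , n)` into the
-- solution `(n , k)` of the same equation.
double-square-even : ∀ m n → m ℕ.* m ≡ 2 ℕ.* (n ℕ.* n) → ∃[ k ] (m ≡ k ℕ.* 2 × n ℕ.* n ≡ 2 ℕ.* (k ℕ.* k))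
double-square-even m n e
  with reduce (euclidsLemma m m prime[2] (divides (n ℕ.* n) (≡.trans e (ℕ.*-comm 2 (n ℕ.* n)))))
... | divides k ≡.refl = k , ≡.refl , ℕ.*-cancelˡ-≡ _ _ 2 (begin
      2 ℕ.* (n ℕ.* n)                ≡⟨ e ⟨
      k ℕ.* 2 ℕ.* (k ℕ.* 2)          ≡⟨ ℕ.[m*n]*[o*p]≡[m*o]*[n*p] k 2 k 2 ⟩
      k ℕ.* k ℕ.* 4                  ≡⟨ ℕ.*-comm (k ℕ.* k) 4 ⟩
      4 ℕ.* (k ℕ.* k)                ≡⟨ ℕ.*-assoc 2 2 (k ℕ.* k) ⟩
      2 ℕ.* (2 ℕ.* (k ℕ.* k))        ∎)
  where open ≡.≡-Reasoning

-- Infinite descent: two halvings lead from `(m , n)` to `(k , l)` with `m = 2k` and `n = 2l`, and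
-- `k < m` because `k` is nonzero.
double-square⇒0 : ∀ m n → Acc ℕ._<_ m → m ℕ.* m ≡ 2 ℕ.* (n ℕ.* n) → n ≡ 0
double-square⇒0 zero zero _ _ = ≡.refl
double-square⇒0 m@(suc _) n (acc rec) e with double-square-even m n e
... | zero , () , _
... | k@(suc _) , m≡k*2 , e′ with double-square-even n k e′
... | l , n≡l*2 , e″ = ≡.trans n≡l*2 (≡.cong (ℕ._* 2)
      (double-square⇒0 k l (rec (≡.subst (k ℕ.<_) (≡.sym m≡k*2) (ℕ.m<m*n k 2 (ℕ.s≤s (ℕ.s≤s ℕ.z≤n))))) e″))

-- Arithmetic of the entries of matrices in H₄

module HeckeFractions (em : ExcludedMiddle 0ℓ) (R : CompleteOrderedField) where
  open Hecke em R
  open RealProperties R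
  open Solver using (solve; _:=_; _:+_; _:*_; _:-_; :-_; con)
  open RingProperties ring using (-0#≈0#; -‿involutive; -‿distribʳ-*)
  open SL₂ using (a; b; c; d; det)
  open ProjectiveSpecialLinear commutativeRing using (entries; _∙_) renaming (_⁻¹ to _⁻¹ₘ)

  0≤x² : ∀ x → 0# ≤ x * x
  0≤x² x with Order.compare x 0#
  ... | tri< x<0 _ _ = inj₁ (Order.<-respʳ-≈ (solve 1 (λ x → :- x :* :- x := x :* x) refl x)
                                             (*-pos (neg-pos x<0) (neg-pos x<0)))
  ... | tri≈ _ x≈0 _ = inj₂ (sym (trans (*-congʳ x≈0) (zeroˡ x)))
  ... | tri> _ _ 0<x = inj₁ (*-pos 0<x 0<x)

  -- A matrix in H₄ has its diagonal in unit s * ℤ and its other two entries in unit (not s) * ℤ.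
  unit : Bool → ℝ
  unit false = 1#
  unit true  = √2

  record Entry (s : Bool) (x : ℝ) : Set where
    constructor entry
    field
      integer : ℤ
      x≈      : x ≈ unit s * ⟦ integer ⟧

  open Entry

  entry-resp : ∀ {s x y} → x ≈ y → Entry s x → Entry s y
  entry-resp x≈y (entry i e) = entry i (trans (sym x≈y) e)

  entry-+ : ∀ {s x y} → Entry s x → Entry s y → Entry s (x + y)
  entry-+ (entry i e) (entry j f) =
    entry (i ℤ.+ j) (trans (+-cong e f) (trans (sym (distribˡ _ _ _)) (*-congˡ (sym (⟦+⟧ i j)))))

  entry-neg : ∀ {s x} → Entry s x → Entry s (- x)
  entry-neg (entry i e) = entry (ℤ.- i) (trans (-‿cong e) (trans (-‿distribʳ-* _ _) (*-congˡ (sym (⟦-⟧ i)))))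

  entry-* : ∀ {s t x y} → Entry s x → Entry t y → Entry (s xor t) (x * y)
  entry-* {s} {t} (entry i e) (entry j f) = entry (k s t ℤ.* (i ℤ.* j)) (begin
    _                                          ≈⟨ *-cong e f ⟩
    unit s * ⟦ i ⟧ * (unit t * ⟦ j ⟧)
      ≈⟨ solve 4 (λ u x v y → u :* x :* (v :* y) := u :* v :* (x :* y)) refl _ _ _ _ ⟩
    unit s * unit t * (⟦ i ⟧ * ⟦ j ⟧)          ≈⟨ *-cong (unit-* s t) (sym (⟦*⟧ i j)) ⟩
    unit (s xor t) * ⟦ k s t ⟧ * ⟦ i ℤ.* j ⟧   ≈⟨ *-assoc _ _ _ ⟩
    unit (s xor t) * (⟦ k s t ⟧ * ⟦ i ℤ.* j ⟧) ≈⟨ *-congˡ (⟦*⟧ (k s t) _) ⟨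
    unit (s xor t) * ⟦ k s t ℤ.* (i ℤ.* j) ⟧   ∎)
    where
    open SetoidReasoning setoid
    -- Only `√2 * √2` leaves the set of units; its factor 2 is moved into the integer.
    k : Bool → Bool → ℤ
    k true true = pos 2
    k _    _    = pos 1
    unit-* : ∀ s t → unit s * unit t ≈ unit (s xor t) * ⟦ k s t ⟧
    unit-* false false = refl
    unit-* false true  = *-comm _ _
    unit-* true  false = refl
    unit-* true  true  = trans √2*√2≈2 (sym (*-identityˡ _))

  unit² : Bool → ℕ
  unit² false = 1
  unit² true  = 2

  unit*unit : ∀ s → unit s * unit s ≈ ι (unit² s)
  unit*unit false = *-identityˡ 1#
  unit*unit true  = √2*√2≈2

  ι-* : ∀ m n → ι (m ℕ.* n) ≈ ι m * ι n
  ι-* m n = trans (reflexive (≡.cong ⟦_⟧ (ℤ.pos-* m n))) (⟦*⟧ (pos m) (pos n))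

  ι-+ : ∀ m n → ι (m ℕ.+ n) ≈ ι m + ι n
  ι-+ m n = ⟦+⟧ (pos m) (pos n)

  ⟦⟧-sq : ∀ i → ⟦ i ⟧ * ⟦ i ⟧ ≈ ι (ℤ.∣ i ∣ ℕ.* ℤ.∣ i ∣)
  ⟦⟧-sq (pos n)  = sym (ι-* n n)
  ⟦⟧-sq -[1+ n ] = trans (solve 1 (λ x → :- x :* :- x := x :* x) refl _) (sym (ι-* (suc n) (suc n)))

  abstract
    entry-sq : ∀ {s x} (e : Entry s x) → x * x ≈ ι (unit² s ℕ.* (ℤ.∣ integer e ∣ ℕ.* ℤ.∣ integer e ∣))
    entry-sq {s} {x} (entry i e) = begin
      x * x                                       ≈⟨ *-cong e e ⟩
      unit s * ⟦ i ⟧ * (unit s * ⟦ i ⟧)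
        ≈⟨ solve 2 (λ u x → u :* x :* (u :* x) := u :* u :* (x :* x)) refl _ _ ⟩
      unit s * unit s * (⟦ i ⟧ * ⟦ i ⟧)           ≈⟨ *-cong (unit*unit s) (⟦⟧-sq i) ⟩
      ι (unit² s) * ι (ℤ.∣ i ∣ ℕ.* ℤ.∣ i ∣)       ≈⟨ ι-* (unit² s) _ ⟨
      ι (unit² s ℕ.* (ℤ.∣ i ∣ ℕ.* ℤ.∣ i ∣))       ∎
      where open SetoidReasoning setoid

  abstract
    entry-sq-pos : ∀ {s x} → Entry s x → 0# < x → ∃[ n ] x * x ≈ ι (suc n)
    entry-sq-pos {s} {x} e 0<x =
      let n , n≡ = ⟦⟧-pos {pos (unit² s ℕ.* (ℤ.∣ integer e ∣ ℕ.* ℤ.∣ integer e ∣))}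
                     (Order.<-respʳ-≈ (entry-sq e) (*-pos 0<x 0<x))
      in n , trans (entry-sq e) (reflexive (≡.cong ⟦_⟧ n≡))

  -- An integer is at most its square in absolute value, so a bound on the square of an entry leaves
  -- finitely many integers.
  entry-abs-≤ : ∀ {s x} (e : Entry s x) → ι ℤ.∣ integer e ∣ ≤ x * x
  entry-abs-≤ {s} e@(entry i _) = ≤-trans (ι-mono-≤ (bound s ℤ.∣ i ∣)) (inj₂ (sym (entry-sq e)))
    where
    bound : ∀ s n → n ℕ.≤ unit² s ℕ.* (n ℕ.* n)
    bound _     zero      = ℕ.z≤n
    bound false n@(suc _) = ℕ.≤-trans (ℕ.m≤m*n n n) (ℕ.m≤n*m (n ℕ.* n) 1)
    bound true  n@(suc _) = ℕ.≤-trans (ℕ.m≤m*n n n) (ℕ.m≤n*m (n ℕ.* n) 2)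

  -- From `x = i = √2 j` follows `i² = 2j²`, so `j` vanishes by descent. The case `true` only
  -- exchanges the two arguments.
  entry-type-unique : ∀ {s x} → Entry s x → Entry (not s) x → x ≈ 0#
  entry-type-unique {false} e f = rational-entry e f
    where
    rational-entry : ∀ {x} → Entry false x → Entry true x → x ≈ 0#
    rational-entry {x} e@(entry i _) f@(entry j x≈) =
      trans x≈ (trans (*-congˡ (reflexive (≡.cong ⟦_⟧ j≡0))) (zeroʳ √2))
      where
      j≡0 = ℤ.∣i∣≡0⇒i≡0 {j} (double-square⇒0 ℤ.∣ i ∣ ℤ.∣ j ∣ (<-wellFounded _)
        (≡.trans (≡.sym (ℕ.*-identityˡ _)) (ι-injective (trans (sym (entry-sq e)) (entry-sq f)))))
  entry-type-unique {true} e f = entry-type-unique {false} f e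

  Typed : Bool → SL₂ → Set
  Typed s M = (Entry s (a M) × Entry s (d M)) × (Entry (not s) (b M) × Entry (not s) (c M))

  -- All four clauses have the same right-hand side. The split makes `xor` and `not` compute, so
  -- that the two products summed in each entry get the same type.
  typed-∙ : ∀ s t {M N} → Typed s M → Typed t N → Typed (s xor t) (M ∙ N)
  typed-∙ false false ((p , q) , (r , u)) ((p′ , q′) , (r′ , u′)) =
    (entry-+ (entry-* p p′) (entry-* r u′) , entry-+ (entry-* u r′) (entry-* q q′)) ,
    (entry-+ (entry-* p r′) (entry-* r q′) , entry-+ (entry-* u p′) (entry-* q u′))
  typed-∙ false true ((p , q) , (r , u)) ((p′ , q′) , (r′ , u′)) =
    (entry-+ (entry-* p p′) (entry-* r u′) , entry-+ (entry-* u r′) (entry-* q q′)) ,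
    (entry-+ (entry-* p r′) (entry-* r q′) , entry-+ (entry-* u p′) (entry-* q u′))
  typed-∙ true false ((p , q) , (r , u)) ((p′ , q′) , (r′ , u′)) =
    (entry-+ (entry-* p p′) (entry-* r u′) , entry-+ (entry-* u r′) (entry-* q q′)) ,
    (entry-+ (entry-* p r′) (entry-* r q′) , entry-+ (entry-* u p′) (entry-* q u′))
  typed-∙ true true ((p , q) , (r , u)) ((p′ , q′) , (r′ , u′)) =
    (entry-+ (entry-* p p′) (entry-* r u′) , entry-+ (entry-* u r′) (entry-* q q′)) ,
    (entry-+ (entry-* p r′) (entry-* r q′) , entry-+ (entry-* u p′) (entry-* q u′))

  typed-resp : ∀ {s M N} → M ≋ N → Typed s M → Typed s N
  typed-resp (inj₁ (entries e f g h)) ((p , q) , (r , u)) =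
    (entry-resp e p , entry-resp h q) , (entry-resp f r , entry-resp g u)
  typed-resp (inj₂ (entries e f g h)) ((p , q) , (r , u)) =
    (flip e p , flip h q) , (flip f r , flip g u)
    where
    flip : ∀ {s x y} → x ≈ - y → Entry s x → Entry s y
    flip x≈-y p = entry-resp (trans (-‿cong x≈-y) (-‿involutive _)) (entry-neg p)

  -- The type behaves like a homomorphism to ℤ/2 that sends the translation to `false` and the
  -- inversion to `true`; inversion of a matrix and change of sign preserve it.
  H₄-typed : ∀ {M} → M ∈ H₄ → ∃[ s ] Typed s M
  H₄-typed (generator isTranslation) = false ,
    (entry (pos 1) (sym (*-identityˡ _)) , entry (pos 1) (sym (*-identityˡ _))) ,
    (entry (pos 1) (sym (*-identityʳ _)) , entry (pos 0) (sym (zeroʳ _)))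
  H₄-typed (generator isInversion) = true ,
    (entry (pos 0) (sym (zeroʳ _)) , entry (pos 0) (sym (zeroʳ _))) ,
    (entry -[1+ 0 ] (sym (*-identityˡ _)) , entry (pos 1) (sym (*-identityˡ _)))
  H₄-typed identity = false ,
    (entry (pos 1) (sym (*-identityˡ _)) , entry (pos 1) (sym (*-identityˡ _))) ,
    (entry (pos 0) (sym (zeroʳ _)) , entry (pos 0) (sym (zeroʳ _)))
  H₄-typed (product {g} {h} p q) with H₄-typed p | H₄-typed q
  ... | s , u | t , v = s xor t , typed-∙ s t {g} {h} u v
  H₄-typed (inverse p) with H₄-typed p
  ... | s , (p , q) , (r , u) = s , (q , p) , (entry-neg r , entry-neg u)
  H₄-typed (resp {g} {h} e p) with H₄-typed p
  ... | s , u = s , typed-resp {s} {g} {h} e u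

  open Fraction public using (matrix; matrix∈; positive)

  abstract
    p-entry : ∀ x → ∃[ s ] (Entry s (p x) × Entry (not s) (q x))
    p-entry x = let s , (e , _) , (_ , f) = H₄-typed (matrix∈ x) in s , e , f

  abstract
    q-sq : ∀ x → ∃[ n ] q x * q x ≈ ι (suc n)
    q-sq x = entry-sq-pos (proj₂ (proj₂ (p-entry x))) (positive x)

  1≤q : ∀ x → 1# ≤ q x
  1≤q x = let n , e = q-sq x in sq-cancel-≤ (positive x)
    (≤-trans (≤-trans (inj₂ (*-identityʳ 1#)) (ι-mono-≤ {1} {suc n} (ℕ.s≤s ℕ.z≤n))) (inj₂ (sym e)))

  q≉0 : ∀ x → q x ≉ 0#
  q≉0 x = >⇒≉ (positive x)

  -- The squares of `x` and `y` are positive integers with product 1, so both are 1, and positivity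
  -- selects the root.
  entry-unit : ∀ {s t x y} → Entry s x → Entry t y → 0# < x → x * y ≈ 1# → x ≈ 1#
  entry-unit {x = x} {y} e f 0<x xy≈1
    with entry-sq-pos e 0<x | entry-sq-pos f (pos-factor 0<x (Order.<-respʳ-≈ (sym xy≈1) 0<1))
  ... | m , x²≈ | n , y²≈ = ≤-antisym (sq-cancel-≤ 0<1 (inj₂ x²≈1²)) (sq-cancel-≤ 0<x (inj₂ (sym x²≈1²)))
    where
    open SetoidReasoning setoid
    m*n≡1 : suc m ℕ.* suc n ≡ 1
    m*n≡1 = ι-injective (begin
      ι (suc m ℕ.* suc n)       ≈⟨ ι-* (suc m) (suc n) ⟩
      ι (suc m) * ι (suc n)     ≈⟨ *-cong x²≈ y²≈ ⟨
      x * x * (y * y)           ≈⟨ solve 2 (λ x y → x :* x :* (y :* y) := x :* y :* (x :* y)) refl x y ⟩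
      x * y * (x * y)           ≈⟨ *-cong xy≈1 xy≈1 ⟩
      1# * 1#                   ≈⟨ *-identityʳ 1# ⟩
      1#                        ∎)
    x²≈1² : x * x ≈ 1# * 1#
    x²≈1² = trans x²≈ (trans (reflexive (≡.cong ι (ℕ.m*n≡1⇒m≡1 (suc m) (suc n) m*n≡1))) (sym (*-identityʳ 1#)))

  -- Two matrices with proportional first columns differ by an upper triangular element of H₄,
  -- whose diagonal entries are mutually inverse with integral squares.
  value-injective : ∀ x y → value x ≈ value y → p x ≈ p y × q x ≈ q y
  value-injective x y vx≈vy = trans (sym (scale e≈1)) ep≈p′ , trans (sym (scale e≈1)) eq≈q′
    where
    open SetoidReasoning setoid
    M = matrix x
    N = matrix y
    h = M ⁻¹ₘ ∙ N
    e = a h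

    pq′≈p′q : p x * q y ≈ p y * q x
    pq′≈p′q = begin
      p x * q y               ≈⟨ *-congʳ (/-*-cancel (q≉0 x)) ⟨
      q x * value x * q y     ≈⟨ *-congʳ (*-congˡ vx≈vy) ⟩
      q x * value y * q y     ≈⟨ solve 3 (λ u v w → u :* v :* w := w :* v :* u) refl _ _ _ ⟩
      q y * value y * q x     ≈⟨ *-congʳ (/-*-cancel (q≉0 y)) ⟩
      p y * q x               ∎

    ep≈p′ : e * p x ≈ p y
    ep≈p′ = begin
      (d M * p y + - b M * q y) * p x
        ≈⟨ solve 5 (λ d P b Q p → (d :* P :+ :- b :* Q) :* p := d :* P :* p :- b :* (p :* Q))
             refl (d M) (p y) (b M) (q y) (p x) ⟩
      d M * p y * p x - b M * (p x * q y)    ≈⟨ +-congˡ (-‿cong (*-congˡ pq′≈p′q)) ⟩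
      d M * p y * p x - b M * (p y * q x)
        ≈⟨ solve 5 (λ d P b q p → d :* P :* p :- b :* (P :* q) := P :* (p :* d :- b :* q))
             refl (d M) (p y) (b M) (q x) (p x) ⟩
      p y * (p x * d M - b M * q x)          ≈⟨ *-congˡ (det M) ⟩
      p y * 1#                               ≈⟨ *-identityʳ _ ⟩
      p y                                    ∎

    eq≈q′ : e * q x ≈ q y
    eq≈q′ = begin
      (d M * p y + - b M * q y) * q x
        ≈⟨ solve 5 (λ d P b Q q → (d :* P :+ :- b :* Q) :* q := d :* (P :* q) :- b :* Q :* q)
             refl (d M) (p y) (b M) (q y) (q x) ⟩
      d M * (p y * q x) - b M * q y * q x    ≈⟨ +-congʳ (*-congˡ pq′≈p′q) ⟨
      d M * (p x * q y) - b M * q y * q x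
        ≈⟨ solve 5 (λ d p b q Q → d :* (p :* Q) :- b :* Q :* q := Q :* (p :* d :- b :* q))
             refl (d M) (p x) (b M) (q x) (q y) ⟩
      q y * (p x * d M - b M * q x)          ≈⟨ *-congˡ (det M) ⟩
      q y * 1#                               ≈⟨ *-identityʳ _ ⟩
      q y                                    ∎

    0<e : 0# < e
    0<e = pos-factor (positive x) (Order.<-respʳ-≈ (trans (sym eq≈q′) (*-comm _ _)) (positive y))

    c≈0 : c h ≈ 0#
    c≈0 = begin
      - q x * p y + p x * q y   ≈⟨ +-congˡ pq′≈p′q ⟩
      - q x * p y + p y * q x   ≈⟨ solve 2 (λ q P → :- q :* P :+ P :* q := con ℤ.0ℤ) refl (q x) (p y) ⟩
      0#                        ∎

    ed≈1 : e * d h ≈ 1#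
    ed≈1 = begin
      e * d h                    ≈⟨ +-identityʳ _ ⟨
      e * d h + 0#               ≈⟨ +-congˡ (trans (-‿cong (trans (*-congˡ c≈0) (zeroʳ _))) -0#≈0#) ⟨
      e * d h - b h * c h        ≈⟨ det h ⟩
      1#                         ∎

    e≈1 : e ≈ 1#
    e≈1 = let _ , (e , f) , _ = H₄-typed (product (inverse (matrix∈ x)) (matrix∈ y))
          in entry-unit e f 0<e ed≈1

    scale : ∀ {e z} → e ≈ 1# → e * z ≈ z
    scale e≈1 = trans (*-congʳ e≈1) (*-identityˡ _)

  -- All of √2ℚ lies in ℚ(H₄)

  -- The factor `r` is arbitrary: a nonzero pair stands for a point of the projective line in the
  -- orbit of ∞, and the Euclidean algorithm need not keep track of a gcd.
  Column : ℝ → ℝ → Set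
  Column u v = ∃[ M ] (M ∈ H₄ × ∃[ r ] (u ≈ r * a M × v ≈ r * c M))

  column-resp : ∀ {u u′ v v′} → u ≈ u′ → v ≈ v′ → Column u v → Column u′ v′
  column-resp e f (M , M∈ , r , g , h) = M , M∈ , r , trans (sym e) g , trans (sym f) h

  column-apply : ∀ {N u v} → N ∈ H₄ → Column u v → Column (a N * u + b N * v) (c N * u + d N * v)
  column-apply {N} {u} {v} N∈ (M , M∈ , r , e , f) = N ∙ M , product N∈ M∈ , r , row (a N) (b N) , row (c N) (d N)
    where
    row : ∀ x y → x * u + y * v ≈ r * (x * a M + y * c M)
    row x y = trans (+-cong (*-congˡ e) (*-congˡ f))
      (solve 5 (λ x y r a c → x :* (r :* a) :+ y :* (r :* c) := r :* (x :* a :+ y :* c)) refl x y r (a M) (c M))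

  column-translate : ∀ {u v} → Column u v → Column (u + √2 * v) v
  column-translate {u} {v} C = column-resp
    (solve 3 (λ s u v → con ℤ.1ℤ :* u :+ s :* v := u :+ s :* v) refl √2 u v)
    (solve 2 (λ u v → con ℤ.0ℤ :* u :+ con ℤ.1ℤ :* v := v) refl u v)
    (column-apply (generator isTranslation) C)

  column-translate⁻¹ : ∀ {u v} → Column u v → Column (u - √2 * v) v
  column-translate⁻¹ {u} {v} C = column-resp
    (solve 3 (λ s u v → con ℤ.1ℤ :* u :+ (:- s) :* v := u :- s :* v) refl √2 u v)
    (solve 2 (λ u v → (:- con ℤ.0ℤ) :* u :+ con ℤ.1ℤ :* v := v) refl u v)
    (column-apply (inverse (generator isTranslation)) C)

  column-rotate : ∀ {u v} → Column u v → Column (- v) u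
  column-rotate {u} {v} C = column-resp
    (solve 2 (λ u v → con ℤ.0ℤ :* u :+ (:- con ℤ.1ℤ) :* v := :- v) refl u v)
    (solve 2 (λ u v → con ℤ.1ℤ :* u :+ con ℤ.0ℤ :* v := u) refl u v)
    (column-apply (generator isInversion) C)

  column-neg : ∀ {u v} → Column u v → Column (- u) (- v)
  column-neg (M , M∈ , r , e , f) = M , M∈ , - r , flip e , flip f
    where
    flip : ∀ {x y} → x ≈ r * y → - x ≈ - r * y
    flip {y = y} x≈ry = trans (-‿cong x≈ry) (solve 2 (λ r y → :- (r :* y) := :- r :* y) refl r y)

  -- The shear is the translation conjugated by the inversion. Two rotations amount to a change of
  -- sign, which `column-neg` undoes.
  column-shear : ∀ {u v} → Column u v → Column u (v - √2 * u)
  column-shear C = column-resp (-‿involutive _)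
    (solve 3 (λ s u v → :- (:- v :+ s :* u) := v :- s :* u) refl _ _ _)
    (column-neg (column-rotate (column-translate (column-rotate C))))

  column-shear⁻¹ : ∀ {u v} → Column u v → Column u (v + √2 * u)
  column-shear⁻¹ C = column-resp (-‿involutive _)
    (solve 3 (λ s u v → :- (:- v :- s :* u) := v :+ s :* u) refl _ _ _)
    (column-neg (column-rotate (column-translate⁻¹ (column-rotate C))))

  private
    √2√2x : ∀ x → √2 * (√2 * x) ≈ x + x
    √2√2x x = trans (sym (*-assoc _ _ _)) (trans (*-congʳ √2*√2≈2)
      (solve 1 (λ x → con (pos 2) :* x := x :+ x) refl x))

  column-shift : ∀ {u x} → Column u (√2 * x) → Column (u + (x + x)) (√2 * x)
  column-shift {x = x} C = column-resp (+-congˡ (√2√2x x)) refl (column-translate C)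

  column-shift⁻¹ : ∀ {u x} → Column u (√2 * x) → Column (u - (x + x)) (√2 * x)
  column-shift⁻¹ {x = x} C = column-resp (+-congˡ (-‿cong (√2√2x x))) refl (column-translate⁻¹ C)

  column-axis : ∀ r → Column r 0#
  column-axis r = _ , identity , r , sym (*-identityʳ r) , sym (zeroʳ r)

  -- A Euclidean algorithm: translations change m by 2n and shears change n by m.  Both signs are
  -- carried along because m - 2n may be negative.
  rational-column : ∀ m n → Acc ℕ._<_ (m ℕ.+ n) →
                    Column (ι m) (√2 * ι n) × Column (- ι m) (√2 * ι n)
  rational-column zero n _ = vertical , column-resp (sym -0#≈0#) refl vertical
    where
    vertical : Column 0# (√2 * ι n)
    vertical = column-resp -0#≈0# refl (column-rotate (column-axis (√2 * ι n)))
  rational-column m zero _ = horizontal _ , horizontal _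
    where
    horizontal : ∀ u → Column u (√2 * ι 0)
    horizontal u = column-resp refl (sym (zeroʳ √2)) (column-axis u)
  rational-column m@(suc m-1) n@(suc n-1) (acc rec) with m ℕ.≤? n
  ... | yes m≤n with ℕ.m≤n⇒∃[o]m+o≡n m≤n
  ... | k , m+k≡n with rational-column m k (rec
    (≡.subst (λ n → m ℕ.+ k ℕ.< m ℕ.+ n) m+k≡n (ℕ.+-monoʳ-< m (ℕ.m<n+m k (ℕ.s≤s ℕ.z≤n)))))
  ... | C⁺ , C⁻ =
    column-resp refl (trans (solve 3 (λ s m k → s :* k :+ s :* m := s :* (m :+ k)) refl _ _ _) (*-congˡ n≈))
      (column-shear⁻¹ C⁺) ,
    column-resp refl (trans (solve 3 (λ s m k → s :* k :- s :* (:- m) := s :* (m :+ k)) refl _ _ _) (*-congˡ n≈))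
      (column-shear C⁻)
    where
    n≈ : ι m + ι k ≈ ι n
    n≈ = trans (sym (ι-+ m k)) (reflexive (≡.cong ι m+k≡n))
  rational-column m@(suc m-1) n@(suc n-1) (acc rec) | no m≰n with ℕ.≤-total (n ℕ.+ n) m
  ... | inj₁ 2n≤m with ℕ.m≤n⇒∃[o]m+o≡n 2n≤m
  ... | k , 2n+k≡m with rational-column k n (rec
    (≡.subst (λ m → k ℕ.+ n ℕ.< m ℕ.+ n) 2n+k≡m (ℕ.+-monoˡ-< n (ℕ.m<n+m k (ℕ.s≤s ℕ.z≤n)))))
  ... | C⁺ , C⁻ =
    column-resp (trans (+-comm _ _) m≈) refl (column-shift {x = ι n} C⁺) ,
    column-resp (trans (solve 2 (λ k n → :- k :- n := :- (n :+ k)) refl _ _) (-‿cong m≈)) refl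
      (column-shift⁻¹ {x = ι n} C⁻)
    where
    m≈ : ι n + ι n + ι k ≈ ι m
    m≈ = trans (+-congʳ (sym (ι-+ n n))) (trans (sym (ι-+ (n ℕ.+ n) k)) (reflexive (≡.cong ι 2n+k≡m)))
  rational-column m@(suc m-1) n@(suc n-1) (acc rec) | no m≰n | inj₂ m≤2n with ℕ.m≤n⇒∃[o]m+o≡n m≤2n
  ... | k , m+k≡2n with rational-column k n (rec (ℕ.+-monoˡ-< n (ℕ.<-trans k<n (ℕ.≰⇒> m≰n))))
    where
    k<n : k ℕ.< n
    k<n = ℕ.+-cancelˡ-< m k n (≡.subst (ℕ._< m ℕ.+ n) (≡.sym m+k≡2n) (ℕ.+-monoˡ-< n (ℕ.≰⇒> m≰n)))
  ... | C⁺ , C⁻ =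
    column-resp m≈ refl (column-shift {x = ι n} C⁻) ,
    column-resp (trans (solve 2 (λ k n → k :- n := :- (:- k :+ n)) refl _ _) (-‿cong m≈)) refl
      (column-shift⁻¹ {x = ι n} C⁺)
    where
    m≈ : - ι k + (ι n + ι n) ≈ ι m
    m≈ = trans (+-congˡ (trans (sym (ι-+ n n)) (trans (reflexive (≡.cong ι (≡.sym m+k≡2n))) (ι-+ m k))))
      (solve 2 (λ m k → :- k :+ (m :+ k) := m) refl (ι m) (ι k))

  column-ratio : ∀ {u v α} → Column u v → v ≉ 0# → v * α ≈ u → α ∈ ℚ[H₄]
  column-ratio {u} {v} {α} (M , M∈ , r , u≈ , v≈) v≉0 vα≈u = M , M∈ , c≉0 , /-unique c≉0 (*-cancelˡ-≈ r≉0 (begin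
    r * (c M * α)    ≈⟨ *-assoc _ _ _ ⟨
    r * c M * α      ≈⟨ *-congʳ v≈ ⟨
    v * α            ≈⟨ vα≈u ⟩
    u                ≈⟨ u≈ ⟩
    r * a M          ∎))
    where
    open SetoidReasoning setoid
    c≉0 : c M ≉ 0#
    c≉0 c≈0 = v≉0 (trans v≈ (trans (*-congˡ c≈0) (zeroʳ r)))
    r≉0 : r ≉ 0#
    r≉0 r≈0 = v≉0 (trans v≈ (trans (*-congʳ r≈0) (zeroˡ _)))

  -- The form `i / (√2 j)` exhausts √2ℚ because `√2 b / c = 2b / (√2 c)`. The sign of `i` selects
  -- the component of `rational-column`.
  √2ℚ⊆ℚ[H₄] : ∀ {α} i {j} → 0# < ⟦ j ⟧ → √2 * ⟦ j ⟧ * α ≈ ⟦ i ⟧ → α ∈ ℚ[H₄]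
  √2ℚ⊆ℚ[H₄] i {j} 0<j e with ⟦⟧-pos {j} 0<j
  √2ℚ⊆ℚ[H₄] (pos m)  {j} 0<j e | n , ≡.refl =
    column-ratio (proj₁ (rational-column m (suc n) (<-wellFounded _))) (>⇒≉ (*-pos 0<√2 0<j)) e
  √2ℚ⊆ℚ[H₄] -[1+ m ] {j} 0<j e | n , ≡.refl =
    column-ratio (proj₂ (rational-column (suc m) (suc n) (<-wellFounded _))) (>⇒≉ (*-pos 0<√2 0<j)) e

  -- The hypothesis makes α equal to `(p₁ + p₂) / 2q`. Numerator and denominator have opposite
  -- types, so exactly one factor √2 remains in the quotient.
  equidistant⇒ℚ[H₄] : ∀ {α} s {p₁ p₂ q} → Entry s p₁ → Entry s p₂ → Entry (not s) q → 0# < q →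
                       q * α - p₁ ≈ - (q * α - p₂) → α ∈ ℚ[H₄]
  equidistant⇒ℚ[H₄] {α} s {p₁} {p₂} {q} e₁ e₂ f 0<q e = case s (entry-+ e₁ e₂) f
    where
    open SetoidReasoning setoid
    sum : q * α + q * α ≈ p₁ + p₂
    sum = begin
      q * α + q * α                     ≈⟨ solve 2 (λ x p → x :+ x := x :- p :+ (x :+ p)) refl (q * α) p₁ ⟩
      q * α - p₁ + (q * α + p₁)         ≈⟨ +-congʳ e ⟩
      - (q * α - p₂) + (q * α + p₁)
        ≈⟨ solve 3 (λ x p r → :- (x :- r) :+ (x :+ p) := p :+ r) refl (q * α) p₁ p₂ ⟩
      p₁ + p₂                           ∎

    case : ∀ s → Entry s (p₁ + p₂) → Entry (not s) q → α ∈ ℚ[H₄]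
    case false (entry i g) (entry j h) = √2ℚ⊆ℚ[H₄] i {j ℤ.+ j} 0<2j (begin
      √2 * ⟦ j ℤ.+ j ⟧ * α              ≈⟨ *-congʳ (*-congˡ (⟦+⟧ j j)) ⟩
      √2 * (⟦ j ⟧ + ⟦ j ⟧) * α
        ≈⟨ solve 3 (λ u j x → u :* (j :+ j) :* x := u :* j :* x :+ u :* j :* x) refl _ _ _ ⟩
      √2 * ⟦ j ⟧ * α + √2 * ⟦ j ⟧ * α   ≈⟨ +-cong (*-congʳ h) (*-congʳ h) ⟨
      q * α + q * α                     ≈⟨ sum ⟩
      p₁ + p₂                           ≈⟨ g ⟩
      1# * ⟦ i ⟧                        ≈⟨ *-identityˡ _ ⟩
      ⟦ i ⟧                             ∎)
      where
      0<j : 0# < ⟦ j ⟧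
      0<j = pos-factor 0<√2 (Order.<-respʳ-≈ h 0<q)
      0<2j : 0# < ⟦ j ℤ.+ j ⟧
      0<2j = Order.<-respʳ-≈ (sym (⟦+⟧ j j)) (+-pos 0<j 0<j)
    -- Here `2jα = √2 i`; dividing by √2 brings this to the required form `√2 j α = i`.
    case true (entry i g) (entry j h) = √2ℚ⊆ℚ[H₄] i {j} 0<j (*-cancelˡ-≈ (>⇒≉ 0<√2) (begin
      √2 * (√2 * ⟦ j ⟧ * α)             ≈⟨ *-congˡ (*-assoc _ _ _) ⟩
      √2 * (√2 * (⟦ j ⟧ * α))           ≈⟨ √2√2x _ ⟩
      ⟦ j ⟧ * α + ⟦ j ⟧ * α             ≈⟨ +-cong (*-congʳ j≈) (*-congʳ j≈) ⟨
      q * α + q * α                     ≈⟨ sum ⟩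
      p₁ + p₂                           ≈⟨ g ⟩
      √2 * ⟦ i ⟧                        ∎))
      where
      j≈ : q ≈ ⟦ j ⟧
      j≈ = trans h (*-identityˡ _)
      0<j : 0# < ⟦ j ⟧
      0<j = Order.<-respʳ-≈ j≈ 0<q

  -- The type of the denominator determines that of the numerator, and a positive denominator cannot
  -- have both types.
  same-denominator⇒same-type : ∀ x y → q x ≈ q y →
    ∃[ s ] (Entry s (p x) × Entry s (p y) × Entry (not s) (q x))
  same-denominator⇒same-type x y qx≈qy with p-entry x | p-entry y
  ... | false , e , f | false , g , _ = false , e , g , f
  ... | true  , e , f | true  , g , _ = true , e , g , f
  ... | false , e , f | true  , _ , h = contradiction (entry-type-unique {true} f (entry-resp (sym qx≈qy) h)) (q≉0 x)
  ... | true  , e , f | false , _ , h = contradiction (entry-type-unique {false} f (entry-resp (sym qx≈qy) h)) (q≉0 x)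

  value-cong : ∀ x y → p x ≈ p y → q x ≈ q y → value x ≈ value y
  value-cong x y p≈ q≈ = /-unique (q≉0 y) (trans (*-congʳ (sym q≈)) (trans (/-*-cancel (q≉0 x)) p≈))

  error-cong : ∀ {α} x y → p x ≈ p y → q x ≈ q y → error α x ≈ error α y
  error-cong x y p≈ q≈ = ∣∣-cong (+-cong (*-congʳ q≈) (-‿cong p≈))

  tie⇒ℚ[H₄] : ∀ {α} x y → value x ≉ value y → q x ≈ q y → error α x ≈ error α y → α ∈ ℚ[H₄]
  tie⇒ℚ[H₄] {α} x y vx≉vy qx≈qy e with ∣x∣≈∣y∣⇒x≈±y e
  ... | inj₁ same = contradiction (value-cong x y px≈py qx≈qy) vx≉vy
    where
    open SetoidReasoning setoid
    px≈py : p x ≈ p y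
    px≈py = begin
      p x                              ≈⟨ solve 2 (λ t p → p := t :- (t :- p)) refl (q x * α) (p x) ⟩
      q x * α - (q x * α - p x)        ≈⟨ +-cong (*-congʳ qx≈qy) (-‿cong same) ⟩
      q y * α - (q y * α - p y)        ≈⟨ solve 2 (λ t p → p := t :- (t :- p)) refl (q y * α) (p y) ⟨
      p y                              ∎
  ... | inj₂ opposite with same-denominator⇒same-type x y qx≈qy
  ... | s , e₁ , e₂ , f = equidistant⇒ℚ[H₄] s e₁ e₂ f (positive x)
    (trans opposite (-‿cong (+-congʳ (*-congʳ (sym qx≈qy)))))

  error-pos : ∀ {α} → ¬ (α ∈ ℚ[H₄]) → ∀ x → 0# < error α x
  error-pos {α} α∉ x = ∣x∣>0 (λ e → α∉ (matrix x , matrix∈ x , q≉0 x , /-unique (q≉0 x)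
    (trans (solve 2 (λ t p → t := t :- p :+ p) refl (q x * α) (p x)) (trans (+-congʳ e) (+-identityˡ _)))))

-- Minima up to finitely many keys

-- A fraction carries a whole matrix, and infinitely many matrices share a first column. Bounded
-- sets of fractions are thus finite only up to a key, here the integers behind numerator and
-- denominator.
module FiniteMinimum (em : ExcludedMiddle 0ℓ) {A I : Set} {_≼_ : Rel A 0ℓ}
  (≼-total : Total _≼_) (≼-trans : Transitive _≼_)
  (Key : I → Pred A 0ℓ) (key-≼ : ∀ {i x y} → x ∈ Key i → y ∈ Key i → x ≼ y)
  (S : Pred A 0ℓ) where

  abstract
    -- Elements with a common key lie below each other, so one representative per key suffices;
    -- excluded middle decides whether `S` contains one.
    minimum : ∀ (keys : List I) y → y ∈ S →
              ∃[ z ] (z ∈ S × z ≼ y × (∀ {i w} → i ∈ₗ keys → w ∈ S → w ∈ Key i → z ≼ w))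
    minimum [] y y∈S = y , y∈S , ≼-refl , λ ()
      where
      ≼-refl : y ≼ y
      ≼-refl with ≼-total y y
      ... | inj₁ y≼y = y≼y
      ... | inj₂ y≼y = y≼y
    minimum (k ∷ keys) y y∈S with minimum keys y y∈S
    ... | z , z∈S , z≼y , least with em {∃[ w ] (w ∈ S × w ∈ Key k)}
    ... | no none = z , z∈S , z≼y , λ
      { (here ≡.refl) w∈S w∈k → contradiction (_ , w∈S , w∈k) none
      ; (there i∈)    w∈S w∈i → least i∈ w∈S w∈i }
    ... | yes (v , v∈S , v∈k) with ≼-total z v
    ... | inj₁ z≼v = z , z∈S , z≼y , λ
      { (here ≡.refl) w∈S w∈k → ≼-trans z≼v (key-≼ v∈k w∈k)
      ; (there i∈)    w∈S w∈i → least i∈ w∈S w∈i }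
    ... | inj₂ v≼z = v , v∈S , ≼-trans v≼z z≼y , λ
      { (here ≡.refl) w∈S w∈k → key-≼ v∈k w∈k
      ; (there i∈)    w∈S w∈i → ≼-trans v≼z (least i∈ w∈S w∈i) }

-- The range from `-n` to `n - 1` is asymmetric; it only has to cover all absolute values below `n`.
bounded-integers : ℕ → List ℤ
bounded-integers n = map pos (upTo n) ++ map -[1+_] (upTo n)

∈-bounded-integers : ∀ {n} i → ℤ.∣ i ∣ ℕ.< n → i ∈ₗ bounded-integers n
∈-bounded-integers     (pos m)  m<n = ∈-++⁺ˡ (∈-map⁺ pos (∈-upTo⁺ m<n))
∈-bounded-integers {n} -[1+ m ] m<n =
  ∈-++⁺ʳ (map pos (upTo n)) (∈-map⁺ -[1+_] (∈-upTo⁺ (ℕ.<-trans (ℕ.n<1+n m) m<n)))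

-- Existence of best approximations

module BestApproximations (em : ExcludedMiddle 0ℓ) (R : CompleteOrderedField) where
  open Hecke em R
  open RealProperties R
  open HeckeFractions em R
  open ExtremaEquality _≈_ using ([_]; ⊤±≈⊤±)
  open Solver using (solve; _:=_; _:+_; _:*_; _:-_; :-_; con)

  abstract
    archimedean-∃ : ∀ b → ∃[ n ] b < ι n
    archimedean-∃ b with em {∃[ n ] b < ι n}
    ... | yes above = above
    ... | no none   = contradiction (λ n → ≮⇒≥ (λ b<ιn → none (n , b<ιn))) (archimedean b)

  sq-≤ : ∀ {x c} → x ≤ c → - x ≤ c → x * x ≤ c * c
  sq-≤ {x} {c} x≤c -x≤c with Order.compare x 0#
  ... | tri≈ _ x≈0 _ = ≤-trans (inj₂ (trans (*-congʳ x≈0) (zeroˡ x))) (0≤x² c)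
  ... | tri> _ _ 0<x = ≤-trans (*-monoʳ-≤ 0<x x≤c) (*-monoˡ-≤ (<-≤-trans 0<x x≤c) x≤c)
  ... | tri< x<0 _ _ = ≤-trans (inj₂ (solve 1 (λ x → x :* x := :- x :* :- x) refl x))
    (≤-trans (*-monoʳ-≤ 0<-x -x≤c) (*-monoˡ-≤ (<-≤-trans 0<-x -x≤c) -x≤c))
    where
    0<-x = neg-pos x<0

  module _ (α : ℝ) where
    infix 4 _≼_

    -- Fractions with denominators c and √2 c′ can have equal errors, so the error alone does not
    -- single out a best approximation.
    _≼_ : Rel Fraction 0ℓ
    x ≼ y = error α x < error α y ⊎ (error α x ≈ error α y × q x ≤ q y)

    ≼-total : Total _≼_
    ≼-total x y with Order.compare (error α x) (error α y)
    ... | tri< lt _ _ = inj₁ (inj₁ lt)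
    ... | tri> _ _ gt = inj₂ (inj₁ gt)
    ... | tri≈ _ e _ with ≤-total (q x) (q y)
    ...   | inj₁ x≤y = inj₁ (inj₂ (e , x≤y))
    ...   | inj₂ y≤x = inj₂ (inj₂ (sym e , y≤x))

    ≼-trans : Transitive _≼_
    ≼-trans (inj₁ x<y)       (inj₁ y<z)       = inj₁ (Order.trans x<y y<z)
    ≼-trans (inj₁ x<y)       (inj₂ (y≈z , _)) = inj₁ (Order.<-respʳ-≈ y≈z x<y)
    ≼-trans (inj₂ (x≈y , _)) (inj₁ y<z)       = inj₁ (Order.<-respˡ-≈ (sym x≈y) y<z)
    ≼-trans (inj₂ (e , f))   (inj₂ (g , h))   = inj₂ (trans e g , ≤-trans f h)

    Key : Bool × ℤ × ℤ → Pred Fraction 0ℓ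
    Key (s , i , j) x = p x ≈ unit s * ⟦ i ⟧ × q x ≈ unit (not s) * ⟦ j ⟧

    key-≼ : ∀ {k x y} → x ∈ Key k → y ∈ Key k → x ≼ y
    key-≼ {x = x} {y} (e , f) (g , h) = inj₂ (error-cong x y px≈py qx≈qy , inj₂ qx≈qy)
      where
      px≈py = trans e (sym g)
      qx≈qy = trans f (sym h)

    -- By the triangle inequality, `|p|` is at most `q |α|` plus the error.
    p²-bound : ∀ Q E → ∃[ b ] ∀ x → q x ≤ Q → error α x ≤ E → p x * p x ≤ b
    p²-bound Q E = C * C , bound
      where
      open ≤-Reasoning
      -- The summand `1#` keeps `A` positive when α is zero, so that `q x ≤ Q` may be multiplied by
      -- it.
      A = ∣ α ∣ + 1#
      C = Q * A + E
      0<A : 0# < A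
      0<A = <-≤-trans 0<1 (≤-trans (inj₂ (sym (+-identityˡ 1#))) (+-monoˡ-≤ 1# (0≤∣x∣ α)))
      ∣α∣<A : ∣ α ∣ < A
      ∣α∣<A = Order.<-respˡ-≈ (+-identityʳ _) (+-monoʳ-< ∣ α ∣ 0<1)
      bound : ∀ x → q x ≤ Q → error α x ≤ E → p x * p x ≤ C * C
      bound x q≤Q e≤E = sq-≤
        (begin
          p x                              ≈⟨ solve 2 (λ t p → p := t :+ :- (t :- p)) refl (q x * α) (p x) ⟩
          q x * α + - (q x * α - p x)      ≤⟨ +-mono-≤ (term (x≤∣x∣ α)) (≤-trans (-x≤∣x∣ _) e≤E) ⟩
          C                                ∎)
        (begin
          - p x
            ≈⟨ solve 3 (λ q a p → :- p := q :* :- a :+ (q :* a :- p)) refl _ α _ ⟩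
          q x * - α + (q x * α - p x)      ≤⟨ +-mono-≤ (term (-x≤∣x∣ α)) (≤-trans (x≤∣x∣ _) e≤E) ⟩
          C                                ∎)
        where
        term : ∀ {β} → β ≤ ∣ α ∣ → q x * β ≤ Q * A
        term β≤ = ≤-trans (*-monoʳ-≤ (positive x) (≤-trans β≤ (inj₁ ∣α∣<A))) (*-monoˡ-≤ 0<A q≤Q)

    abstract
      finitely-many : ∀ Q E → ∃[ keys ] ∀ x → q x ≤ Q → error α x ≤ E → ∃[ k ] (k ∈ₗ keys × x ∈ Key k)
      finitely-many Q E with p²-bound Q E
      ... | b , p²≤b with archimedean-∃ b | archimedean-∃ (Q * Q)
      ... | m , b<m | n , Q²<n =
        keys , cover
        where
        keys : List (Bool × ℤ × ℤ)
        keys = cartesianProduct (true ∷ false ∷ []) (cartesianProduct (bounded-integers m) (bounded-integers n))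
        both : ∀ s → s ∈ₗ (true ∷ false ∷ [])
        both true  = here ≡.refl
        both false = there (here ≡.refl)
        cover : ∀ x → q x ≤ Q → error α x ≤ E → ∃[ k ] (k ∈ₗ keys × x ∈ Key k)
        cover x q≤Q e≤E with p-entry x
        ... | s , e@(entry i x≈) , f@(entry j y≈) = (s , i , j) ,
          ∈-cartesianProduct⁺ (both s) (∈-cartesianProduct⁺
            (∈-bounded-integers i (ι-cancel-< {n = m} (≤-<-trans (≤-trans (entry-abs-≤ e) (p²≤b x q≤Q e≤E)) b<m)))
            (∈-bounded-integers j (ι-cancel-< {n = n} (≤-<-trans (≤-trans (entry-abs-≤ f) q²≤Q²) Q²<n)))) ,
          x≈ , y≈
          where
          q²≤Q² : q x * q x ≤ Q * Q
          q²≤Q² = ≤-trans (*-monoʳ-≤ (positive x) q≤Q) (*-monoˡ-≤ (<-≤-trans (positive x) q≤Q) q≤Q)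

    best-approximation-below : ¬ (α ∈ ℚ[H₄]) → ∀ y →
      ∃[ z ] (IsBestApproximation α z × q z ≤ q y × error α z ≤ error α y)
    best-approximation-below α∉ y =
      let keys , cover                = finitely-many (q y) (error α y)
          z , (qz≤ , ez≤) , _ , least = minimum keys y (inj₂ refl , inj₂ refl)
      in z , minimal⇒best {z} (λ w qw≤ ew≤ →
           let qw≤qy        = ≤-trans qw≤ qz≤
               ew≤ey        = ≤-trans ew≤ ez≤
               k , k∈ , w∈k = cover w qw≤qy ew≤ey
           in least {k} {w} k∈ (qw≤qy , ew≤ey) w∈k) , qz≤ , ez≤
      where
      -- Bounding the error together with the denominator bounds the numerator, so finitely many
      -- keys cover this set.
      open FiniteMinimum em {_≼_ = _≼_} ≼-total (λ {x} {y} {z} → ≼-trans {x} {y} {z})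
        Key (λ {k} {x} {y} → key-≼ {k} {x} {y}) (λ w → q w ≤ q y × error α w ≤ error α y)

      -- A competitor that is no worse is at least `z` in the order `≼`. This leaves only equal
      -- errors with equal denominators, a tie that α outside ℚ(H₄) forbids.
      minimal⇒best : ∀ {z} → (∀ w → q w ≤ q z → error α w ≤ error α z → z ≼ w) → IsBestApproximation α z
      minimal⇒best {z} minimal w vw≉vz qw≤qz = beats (Order.compare (error α z) (error α w))
        where
        beats-if-≼ : z ≼ w → error α z < error α w
        beats-if-≼ (inj₁ ez<ew)           = ez<ew
        beats-if-≼ (inj₂ (ez≈ew , qz≤qw)) =
          contradiction (tie⇒ℚ[H₄] w z vw≉vz (≤-antisym qw≤qz qz≤qw) (sym ez≈ew)) α∉
        beats : Tri (error α z < error α w) (error α z ≈ error α w) (error α w < error α z) →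
                error α z < error α w
        beats (tri< ez<ew _ _) = ez<ew
        beats (tri≈ _ ez≈ew _) = beats-if-≼ (minimal w qw≤qz (inj₂ (sym ez≈ew)))
        beats (tri> _ _ ew<ez) = beats-if-≼ (minimal w qw≤qz (inj₁ ew<ez))

  -- The assumptions make `S` and `T` empty together, so the value +∞ is covered; the lower bound of
  -- `S` rules out -∞ for both.
  inf-cofinal : (S T : Pred ℝ 0ℓ) → ∃ (IsLowerBound S) → (∀ {t} → t ∈ T → t ∈ S) →
                (∀ {s} → s ∈ S → ∃[ t ] (t ∈ T × t ≤ s)) → inf S ≈± inf T
  inf-cofinal S T (l , l≤) T⊆S below
    with em {∃ S} | em {∃ (IsLowerBound S)} | em {∃ T} | em {∃ (IsLowerBound T)}
  ... | no _        | _          | no _        | _          = ⊤±≈⊤±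
  ... | no empty    | _          | yes (t , t∈) | _         = contradiction (t , T⊆S t∈) empty
  ... | yes (s , s∈) | _         | no empty    | _          =
    contradiction (proj₁ (below s∈) , proj₁ (proj₂ (below s∈))) empty
  ... | yes _       | no ¬bound  | yes _       | _          = contradiction (l , λ {_} → l≤) ¬bound
  ... | yes _       | yes _      | yes _       | no ¬bound  = contradiction (l , λ {_} t∈ → l≤ (T⊆S t∈)) ¬bound
  ... | yes ∃S      | yes boundS | yes ∃T      | yes boundT =
    [ ≤-antisym (greatestT (λ t∈ → lowerS (T⊆S t∈))) (greatestS (λ s∈ → lowerT-below (below s∈))) ]
    where
    lowerS = proj₁ (proj₂ (infimum S ∃S boundS))
    greatestS = proj₂ (proj₂ (infimum S ∃S boundS))
    lowerT = proj₁ (proj₂ (infimum T ∃T boundT))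
    greatestT = proj₂ (proj₂ (infimum T ∃T boundT))
    lowerT-below : ∀ {s} → ∃[ t ] (t ∈ T × t ≤ s) → proj₁ (infimum T ∃T boundT) ≤ s
    lowerT-below (t , t∈ , t≤s) = ≤-trans (lowerT t∈) t≤s

  -- The witness is the larger of `q` and `κ / e`: the second lies below `q′` and satisfies the
  -- bound on the product, but may fall short of `q`.
  below-product : ∀ {κ q q′ e} → 0# < e → q < q′ → κ < q′ * e → ∃[ N ] (q ≤ N × κ ≤ N * e × N < q′)
  below-product {κ} {q} {q′} {e} 0<e q<q′ κ<q′e = choose (≤-total q (κ / e))
    where
    κ≈ : κ ≈ κ / e * e
    κ≈ = sym (trans (*-comm _ _) (/-*-cancel (>⇒≉ 0<e)))
    choose : q ≤ κ / e ⊎ κ / e ≤ q → ∃[ N ] (q ≤ N × κ ≤ N * e × N < q′)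
    choose (inj₁ q≤κ/e) = κ / e , q≤κ/e , inj₂ κ≈ , *-cancelˡ-< 0<e
      (Order.<-respˡ-≈ (trans κ≈ (*-comm _ _)) (Order.<-respʳ-≈ (*-comm _ _) κ<q′e))
    choose (inj₂ κ/e≤q) = q , inj₂ refl , ≤-trans (inj₂ κ≈) (*-monoˡ-≤ 0<e κ/e≤q) , q<q′

  -- The sequence of best approximations

  module _ (α : ℝ) (x : ℕ → Fraction) (isSeq : IsBestApproximationSequence α x) where
    open IsBestApproximationSequence isSeq

    u : ℕ → ℝ
    u i = q (x (suc i)) * error α (x i)

    q-mono-≤ : ∀ {i j} → i ℕ.≤ j → q (x i) ≤ q (x j)
    q-mono-≤ {i} i≤j = climb (ℕ.≤⇒≤′ i≤j)
      where
      climb : ∀ {j} → i ℕ.≤′ j → q (x i) ≤ q (x j)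
      climb ℕ.≤′-refl         = inj₂ refl
      climb (ℕ.≤′-step i≤′j) = ≤-trans (climb i≤′j) (inj₁ (increasing _))

    q-cancel-< : ∀ {i j} → q (x i) < q (x j) → i ℕ.< j
    q-cancel-< qi<qj = ℕ.≰⇒> (λ j≤i → <⇒≱ qi<qj (q-mono-≤ j≤i))

    -- Bestness of `x j` speaks only of fractions with another value; equal values have the same
    -- normalized pair and hence the same error.
    error-antimono-≤ : ∀ {i j} → i ℕ.≤ j → error α (x j) ≤ error α (x i)
    error-antimono-≤ {i} {j} i≤j with em {value (x i) ≈ value (x j)}
    ... | yes same     =
      let p≈ , q≈ = value-injective (x i) (x j) same in inj₂ (sym (error-cong (x i) (x j) p≈ q≈))
    ... | no different = inj₁ (best j (x i) different (q-mono-≤ i≤j))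

    -- The squares of the denominators are integers, so they grow by at least 1.
    q-growth : ∀ i → ∃[ n ] (i ℕ.≤ n × q (x i) * q (x i) ≈ ι (suc n))
    q-growth zero    = let n , e = q-sq (x 0) in n , ℕ.z≤n , e
    q-growth (suc i) =
      let m , i≤m , e = q-growth i
          n , f       = q-sq (x (suc i))
      in n , ℕ.≤-<-trans i≤m (ℕ.s<s⁻¹ (ι-cancel-< {suc m} {suc n}
           (Order.<-respˡ-≈ e (Order.<-respʳ-≈ f (sq-mono-< (positive (x i)) (increasing i)))))) , f

    q-unbounded : ∀ b → ∃[ i ] b < q (x i)
    q-unbounded b =
      let i , b²<i    = archimedean-∃ (b * b)
          n , i≤n , e = q-growth i
      in i , sq-cancel-< (positive (x i))
           (<-≤-trans b²<i (≤-trans (ι-mono-≤ (ℕ.m≤n⇒m≤1+n i≤n)) (inj₂ (sym e))))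

    between-denominators : ∀ n {N} → q (x n) ≤ N → ∃[ i ] (n ℕ.≤ i × q (x i) ≤ N × N < q (x (suc i)))
    between-denominators n {N} qn≤N =
      let m , N<qm = q-unbounded N in search m n qn≤N (<-≤-trans N<qm (q-mono-≤ (ℕ.m≤m+n m n)))
      where
      -- `k` is fuel: `N` is known to lie below the denominator `k` places ahead.
      search : ∀ k n → q (x n) ≤ N → N < q (x (k ℕ.+ n)) → ∃[ i ] (n ℕ.≤ i × q (x i) ≤ N × N < q (x (suc i)))
      search zero    n qn≤N N<q = contradiction qn≤N (<⇒≱ N<q)
      search (suc k) n qn≤N N<q with em {N < q (x (suc n))}
      ... | yes N<q′ = n , ℕ.≤-refl , qn≤N , N<q′
      ... | no N≮q′  =
        let i , n<i , found = search k (suc n) (≮⇒≥ N≮q′) (≡.subst (λ m → N < q (x m)) (≡.sym (ℕ.+-suc k n)) N<q)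
        in i , ℕ.<⇒≤ n<i , found

    -- The best approximation below `y` has the value of some `x j`. Equal values give equal
    -- denominators, so `j ≤ i`, and errors do not increase along the sequence.
    error-minimal : ¬ (α ∈ ℚ[H₄]) → ∀ i y → q y < q (x (suc i)) → error α (x i) ≤ error α y
    error-minimal α∉ i y qy< =
      let z , z-best , qz≤qy , ez≤ey = best-approximation-below α α∉ y
          j , same                   = exhaustive z z-best
          p≈ , q≈                    = value-injective (x j) z same
          qj<                        = ≤-<-trans (≤-trans (inj₂ q≈) qz≤qy) qy<
      in ≤-trans (error-antimono-≤ (ℕ.s≤s⁻¹ (q-cancel-< qj<)))
                 (≤-trans (inj₂ (error-cong (x j) z p≈ q≈)) ez≤ey)

    -- `Admissible` and `TailSupremum` repeat the sets inside `K` and `limsup`, so that the final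
    -- equation is definitionally one between their infima.
    Admissible : Pred ℝ 0ℓ
    Admissible κ = 0# < κ × (∃[ N₀ ] ∀ N → N₀ ≤ N →
                     ∃[ y ] (error α y < κ / N × 1# ≤ q y × q y ≤ N))

    TailSupremum : Pred ℝ 0ℓ
    TailSupremum s = ∃[ n ] IsSupremum (λ y → ∃[ k ] (n ℕ.≤ k × y ≈ u k)) s

    -- Admissible constants and suprema of tails

    module _ (α∉ : ¬ (α ∈ ℚ[H₄])) where

      private
        0<error : ∀ k → 0# < error α (x k)
        0<error k = error-pos α∉ (x k)

        0<u : ∀ k → 0# < u k
        0<u k = *-pos (positive (x (suc k))) (0<error k)

      -- For `N` below the next denominator, `N` times the error of `x i` is strictly less than
      -- `u i`, because that error is positive. This yields the strict inequality demanded in `K`.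
      tailSupremum⇒admissible : ∀ {s} → s ∈ TailSupremum → s ∈ Admissible
      tailSupremum⇒admissible {s} (n , upper , _) = <-≤-trans (0<u n) (u≤s ℕ.≤-refl) , q (x n) , approximate
        where
        u≤s : ∀ {k} → n ℕ.≤ k → u k ≤ s
        u≤s n≤k = upper (_ , n≤k , refl)
        error< : ∀ {i N} → 0# < N → n ℕ.≤ i → N < q (x (suc i)) → error α (x i) < s / N
        error< {i} {N} 0<N n≤i N<q = *-cancelˡ-< 0<N (begin-strict
          N * error α (x i)            <⟨ *-monoˡ-< (0<error i) N<q ⟩
          u i                          ≤⟨ u≤s n≤i ⟩
          s                            ≈⟨ /-*-cancel (>⇒≉ 0<N) ⟨
          N * (s / N)                  ∎)
          where open ≤-Reasoning
        approximate : ∀ N → q (x n) ≤ N → ∃[ y ] (error α y < s / N × 1# ≤ q y × q y ≤ N)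
        approximate N qn≤N =
          let i , n≤i , qi≤N , N<q = between-denominators n qn≤N
          in x i , error< (<-≤-trans (positive (x n)) qn≤N) n≤i N<q , 1≤q (x i) , qi≤N

      -- If `κ < u k`, a suitable `N` below the next denominator has `κ` at most `N` times the error
      -- of `x k`. The fraction that admissibility supplies for this `N` would then beat `x k`.
      admissible⇒tail-bounded : ∀ {κ} → κ ∈ Admissible → ∃[ n ] ∀ k → n ℕ.≤ k → u k ≤ κ
      admissible⇒tail-bounded {κ} (_ , N₀ , approximate) =
        -- The `N` chosen in `refute` is at least `q (x k)`, so denominators beyond `N₀` keep it in
        -- the admissible range.
        let n , N₀<qn = q-unbounded N₀
        in n , λ k n≤k → ≮⇒≥ (refute k (<-≤-trans N₀<qn (q-mono-≤ n≤k)))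
        where
        refute : ∀ k → N₀ < q (x k) → ¬ (κ < u k)
        refute k N₀<qk κ<uk =
          let N , qk≤N , κ≤Ne , N<q = below-product (0<error k) (increasing k) κ<uk
              y , ey<κ/N , _ , qy≤N = approximate N (≤-trans (inj₁ N₀<qk) qk≤N)
              0<N                   = <-≤-trans (positive (x k)) qk≤N
              Ney<κ                 = Order.<-respʳ-≈ (/-*-cancel (>⇒≉ 0<N)) (*-monoʳ-< 0<N ey<κ/N)
          in <⇒≱ (*-cancelˡ-< 0<N (<-≤-trans Ney<κ κ≤Ne)) (error-minimal α∉ k y (≤-<-trans qy≤N N<q))

      -- Completeness gives the bounded tail a real supremum, as `limsup` ranges only over tails
      -- that have one.
      admissible⇒tailSupremum : ∀ {κ} → κ ∈ Admissible → ∃[ s ] (s ∈ TailSupremum × s ≤ κ)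
      admissible⇒tailSupremum {κ} κ∈ =
        let s , upper , least = complete (Tail n) (u n , n , ℕ.≤-refl , refl) (κ , bound)
        in s , (n , upper , least) , least bound
        where
        Tail : ℕ → Pred ℝ 0ℓ
        Tail n y = ∃[ k ] (n ℕ.≤ k × y ≈ u k)
        n = proj₁ (admissible⇒tail-bounded κ∈)
        bound : IsUpperBound (Tail n) κ
        bound (k , n≤k , y≈) = ≤-trans (inj₂ y≈) (proj₂ (admissible⇒tail-bounded κ∈) k n≤k)

      K≈limsup : K α ≈± limsup u
      K≈limsup = inf-cofinal Admissible TailSupremum (0# , λ (0<κ , _) → inj₁ 0<κ)
        tailSupremum⇒admissible admissible⇒tailSupremum

lemma4p4 : (em : ExcludedMiddle 0ℓ) (R : CompleteOrderedField) →
    let open Hecke em R in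
    (α : ℝ) → ¬ (α ∈ ℚ[H₄]) →
    (x : ℕ → Fraction) → IsBestApproximationSequence α x →
    K α ≈± limsup (λ i → q (x (suc i)) * error α (x i))
lemma4p4 em R α α∉ x isSeq = BestApproximations.K≈limsup em R α x isSeq α∉
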